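{- For $n\geq 1$, $$P^{(\mathsf{nest}, \mathsf{cros}, \mathsf{exc}, \mathsf{fix})}(\mathfrak{S}_n; p, q, tq, r)=\left(\frac{1+xt}{1+x}\right)^{n}P^{(\mathsf{nest}, \mathsf{cros},\mathsf{cpk}, \mathsf{exc}, \mathsf{fix})}\left(\mathfrak{S}_n; p, q, \frac{(1+x)^{2}t}{(x+t)(1+xt)},\frac{q(x+t)}{1+xt}, \frac{(1+x)r}{1+xt}\right),$$ equivalently, $$P^{(\mathsf{nest}, \mathsf{cros}, \mathsf{cpk}, \mathsf{exc}, \mathsf{fix})}(\mathfrak{S}_n; p, q, x, qt, r)=\left(\frac{1+u}{1+uv}\right)^{n}P^{(\mathsf{nest}, \mathsf{cros}, \mathsf{exc}, \mathsf{fix})}\left(\mathfrak{S}_n; p, q, qv, \frac{(1+uv)r}{1+u}\right),$$ where $u=\frac{1+t^{2}-2xt-(1-t)\sqrt{(1+t)^{2}-4xt}}{2(1-x)t}$ and $v=\frac{(1+t)^{2}-2xt-(1+t)\sqrt{(1+t)^{2}-4xt}}{2xt}$.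
   Context: $\mathfrak{S}_n$ is the set of permutations of $[n]$. $P^{(\mathsf{stat}_1,\ldots,\mathsf{stat}_m)}(\Omega;t_1,\ldots,t_m)=\sum_{\sigma\in\Omega}\prod_j t_j^{\mathsf{stat}_j\sigma}$. For $\sigma\in\mathfrak{S}_n$: $\mathsf{exc}\,\sigma=\#\{i:\sigma(i)>i\}$, $\mathsf{fix}\,\sigma=\#\{i:\sigma(i)=i\}$, $\mathsf{cpk}\,\sigma=\#\{x\in[n]:\sigma^{ -1}(x)<x>\sigma(x)\}$; $\mathsf{nest}_i\sigma=\#\{j: j<i<\sigma(i)<\sigma(j)\text{ or }\sigma(j)<\sigma(i)\le i<j\}$, $\mathsf{cros}_i\sigma=\#\{j: j<i<\sigma(j)<\sigma(i)\text{ or }\sigma(i)<\sigma(j)\le i<j\}$, $\mathsf{nest}=\sum_{i=1}^n\mathsf{nest}_i$, $\mathsf{cros}=\sum_{i=1}^n\mathsf{cros}_i$. -}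

module Defs where

open import Algebra.Bundles using (CommutativeRing)
import Algebra.Definitions
open import Data.Fin using (Fin; zero; suc; _<_; _≤_)
open import Data.Fin.Properties using (_<?_; _≤?_; _≟_; 0≢1+n; punchIn-injective)
open import Data.Fin.Permutation as Perm
  using (Permutation′; _⟨$⟩ʳ_; _⟨$⟩ˡ_; insert; remove; insert-punchIn; insert-remove)
import Data.List as List
open import Data.List using (List; []; _∷_; length; filter; map; concatMap; allFin)
open import Data.List.Membership.Propositional.Properties using (∈-allFin)
open import Data.List.Relation.Unary.All as All using (All)
import Data.List.Relation.Unary.All.Properties as All
open import Data.List.Relation.Unary.AllPairs as AllPairs using (AllPairs; []; _∷_)
import Data.List.Relation.Unary.AllPairs.Properties as AllPairs
open import Data.List.Relation.Unary.Any as Any using (Any; here)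
import Data.List.Relation.Unary.Any.Properties as Any
open import Data.List.Relation.Unary.Unique.Propositional.Properties using (allFin⁺)
open import Data.Nat using (ℕ; zero; suc)
import Data.Nat.Properties as ℕ
open import Data.Product using (_×_; _,_)
open import Data.Sum using (_⊎_)
open import Data.Vec as Vec using (Vec)
open import Level using (Level; _⊔_)
open import Relation.Binary.PropositionalEquality
  using (_≡_; _≢_; refl; sym; trans; cong)
open import Relation.Nullary using (¬_)
open import Relation.Nullary.Decidable using (_×-dec_; _⊎-dec_)
open import Relation.Unary using (Pred; Decidable)

open import Algebra.Properties.CommutativeMonoid.Sum ℕ.+-0-commutativeMonoid
  using (sum-syntax)

private
  variable
    a c ℓ : Level
    m n : ℕ
    A : Set a

-- Any permutation of Fin (suc n) arises exactly once by choosing the image j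
-- of 0 and a permutation of the remaining n positions.  Permutations are
-- compared by pointwise equality Perm._≈_, since the bijection records
-- carry proofs.
𝔖 : ∀ n → List (Permutation′ n)
𝔖 zero    = Perm.id ∷ []
𝔖 (suc n) = concatMap (λ j → map (insert zero j) (𝔖 n)) (allFin (suc n))

private
  insert-cong : ∀ (j : Fin (suc n)) (π ρ : Permutation′ n) → π Perm.≈ ρ →
                insert zero j π Perm.≈ insert zero j ρ
  insert-cong j π ρ π≈ρ zero    = refl
  insert-cong j π ρ π≈ρ (suc k) = trans (insert-punchIn zero j π k)
    (trans (cong (Data.Fin.punchIn j) (π≈ρ k)) (sym (insert-punchIn zero j ρ k)))

  insert-injective : ∀ (j : Fin (suc n)) (π ρ : Permutation′ n) →
                     insert zero j π Perm.≈ insert zero j ρ → π Perm.≈ ρ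
  insert-injective j π ρ eq k = punchIn-injective j _ _
    (trans (sym (insert-punchIn zero j π k))
           (trans (eq (suc k)) (insert-punchIn zero j ρ k)))

𝔖-complete : ∀ n (π : Permutation′ n) → Any (π Perm.≈_) (𝔖 n)
𝔖-complete zero    π = here λ ()
𝔖-complete (suc n) π =
  Any.concatMap⁺ (λ j → map (insert zero j) (𝔖 n))
    (Any.map (λ { refl → Any.map⁺ (Any.map step (𝔖-complete n (remove zero π))) })
             (∈-allFin (π ⟨$⟩ʳ zero)))
  where
  step : ∀ {ρ} → remove zero π Perm.≈ ρ → π Perm.≈ insert zero (π ⟨$⟩ʳ zero) ρ
  step {ρ} eq k = trans (sym (insert-remove zero π k))
    (insert-cong (π ⟨$⟩ʳ zero) (remove zero π) ρ eq k)

𝔖-unique : ∀ n → AllPairs (λ π ρ → ¬ π Perm.≈ ρ) (𝔖 n)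
𝔖-unique zero    = All.[] ∷ []
𝔖-unique (suc n) = AllPairs.concat⁺
  (All.map⁺ (All.universal
    (λ j → AllPairs.map⁺ (AllPairs.map (λ {π} {ρ} π≉ρ eq → π≉ρ (insert-injective j π ρ eq))
                                       (𝔖-unique n)))
    (allFin (suc n))))
  (AllPairs.map⁺ (AllPairs.map
    (λ j≢k → All.map⁺ (All.universal (λ π →
             All.map⁺ (All.universal (λ ρ eq → j≢k (eq zero)) (𝔖 n))) (𝔖 n)))
    (allFin⁺ (suc n))))

# : {P : Pred (Fin n) ℓ} → Decidable P → ℕ
# {n = n} P? = length (filter P? (allFin n))

-- Positions and values run over Fin n, i.e. [n] shifted down by one; every
-- statistic depends only on the relative order of positions and values.
exc fix cpk : Permutation′ n → ℕ
exc σ = # λ i → i <? σ ⟨$⟩ʳ i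
fix σ = # λ i → σ ⟨$⟩ʳ i ≟ i
cpk σ = # λ x → (σ ⟨$⟩ˡ x <? x) ×-dec (σ ⟨$⟩ʳ x <? x)

nestAt crosAt : Permutation′ n → Fin n → ℕ
nestAt σ i = # λ j →
  (j <? i ×-dec i <? σ ⟨$⟩ʳ i ×-dec σ ⟨$⟩ʳ i <? σ ⟨$⟩ʳ j) ⊎-dec
  (σ ⟨$⟩ʳ j <? σ ⟨$⟩ʳ i ×-dec σ ⟨$⟩ʳ i ≤? i ×-dec i <? j)
crosAt σ i = # λ j →
  (j <? i ×-dec i <? σ ⟨$⟩ʳ j ×-dec σ ⟨$⟩ʳ j <? σ ⟨$⟩ʳ i) ⊎-dec
  (σ ⟨$⟩ʳ i <? σ ⟨$⟩ʳ j ×-dec σ ⟨$⟩ʳ j ≤? i ×-dec i <? j)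

nest cros : Permutation′ n → ℕ
nest {n} σ = ∑[ i < n ] nestAt σ i
cros {n} σ = ∑[ i < n ] crosAt σ i

module Over (R : CommutativeRing c ℓ) where
  open CommutativeRing R hiding (zero; refl; sym; trans)
  open import Algebra.Properties.Semiring.Exp semiring public using (_^_)

  P : Vec (A → ℕ) m → List A → Vec Carrier m → Carrier
  P {A = A} stats Ω ts = List.foldr _+_ 0# (map weight Ω)
    where
    weight : A → Carrier
    weight σ = Vec.foldr′ _*_ 1# (Vec.zipWith (λ stat t → t ^ stat σ) stats ts)

  2# 4# : Carrier
  2# = 1# + 1#
  4# = 2# + 2#

  Unit : Carrier → Set (c ⊔ ℓ)
  Unit = Algebra.Definitions.Invertible _≈_ 1# _*_

  -- A quotient may be formed only over an invertible denominator; the inverse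
  -- is unique up to _≈_, so its value does not depend on the given witness.
  infixl 7 _/_
  _/_ : (x y : Carrier) → {{Unit y}} → Carrier
  (x / y) {{y⁻¹ , _}} = x * y⁻¹

{-# OPTIONS --safe #-}
module Submission where

open import Defs
open import Algebra.Bundles using (CommutativeRing)
open import Data.Bool using (if_then_else_)
open import Data.Fin using (Fin; zero; suc; toℕ; fromℕ<; punchIn; punchOut)
open import Data.Fin.Permutation as Perm
  using (Permutation′; _⟨$⟩ʳ_; _⟨$⟩ˡ_; insert; remove; insert-punchIn; insert-remove; inverseˡ; inverseʳ)
open import Data.Fin.Properties as Fin using (toℕ<n)
open import Data.List using (List; []; _∷_; _++_; length; filter; tabulate; allFin; map; concatMap; foldr)
open import Data.List.Membership.Propositional.Properties using (∈-allFin)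
open import Data.List.Relation.Unary.All as All using (All; []; _∷_)
import Data.List.Relation.Unary.All.Properties as All
open import Data.List.Relation.Unary.AllPairs as AllPairs using (AllPairs; []; _∷_)
import Data.List.Relation.Unary.AllPairs.Properties as AllPairs
open import Data.List.Relation.Unary.Any as Any using (Any; here; there)
import Data.List.Relation.Unary.Any.Properties as Any
open import Data.List.Relation.Unary.Unique.Propositional.Properties using (allFin⁺)
open import Data.Nat as ℕ using (ℕ; zero; suc; _∸_; _≤_; _<_; _≥_; z≤n; s≤s; s≤s⁻¹; s<s; s<s⁻¹)
open import Data.Nat.Properties as ℕ
  using (≤-trans; <⇒≱; ≤∧≢⇒<; ≤-refl; ≤-reflexive; <-irrefl; ≤-<-trans; <-≤-trans; ≰⇒>; n≤1+n)
open import Data.Product using (_×_; _,_; proj₁; proj₂; ∃-syntax)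
open import Data.Sum using (_⊎_; inj₁; inj₂)
open import Data.Vec using ([]; _∷_)
open import Function using (_∘_; id)
open import Function.Bundles using (_⇔_; mk⇔; Equivalence)
open import Level using (Level)
open import Relation.Binary.Definitions using (tri<; tri≈; tri>) renaming (Decidable to Decidable₂)
open import Relation.Binary.PropositionalEquality as ≡ using (_≡_; _≢_; cong; cong₂; subst; subst₂)
open import Relation.Nullary using (¬_; Dec; yes; no; does; contradiction)
open import Relation.Nullary.Decidable using (_×-dec_; _⊎-dec_; _→-dec_; dec-yes)
open import Relation.Unary using (Pred; Decidable)
open import Algebra.Properties.CommutativeMonoid.Sum ℕ.+-0-commutativeMonoid using (sum-cong-≗)
open Equivalence using (to; from)

-- Draw σ as arcs between positions and values on the line of events value 0,
-- position 0, value 1, position 1, …, where an arc from position i to value σ(i)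
-- points right if i < σ(i) and left otherwise; nest and cros count the nestings and
-- crossings of arcs with the same direction. Read the line from left to right. When
-- h arcs are open in either direction, closing one of them contributes [h] = Σ p^k
-- q^(h-1-k), and removing the closed arc leaves a smaller permutation with h or h -
-- 1 open arcs. Thus, with X, T and r marking cpk, exc and fix, the generating
-- function is a sum over Motzkin paths with weights 1 for an up step, (T + q)[h] +
-- r p^h for a level step and X T [h]² for a down step. Since there are as many up
-- as down steps, multiplying level weights by κ and down weights by κ² multiplies
-- the sum over paths of length n by κⁿ, and both identities are instances of this.

-- A partly read diagram is again a permutation: closed arcs are deleted and the other ends
-- renumbered, so that the open ends are the first positions and the first values. `Avoids b c`
-- records `b` open positions and `c` open values, and reading alternates between the states (h, h)
-- and (h, h + 1). The obstacle is the renumbering. It keeps the order of the positions and the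
-- order of the values, but deleting an arc from x to y shifts the positions beyond x and the values
-- beyond y, which can alter the comparison of a position with a value. Open ends prevent this, with
-- one exception: closing the value g + 1 can turn an arc from g + 1 to g into a fixed point. Hence
-- the change of `fix` and `cpk` is known only once the next position is read as well, and the
-- recursion treats these two events together. Neither paths nor [h] appear in it: the partial sums
-- `G n h` for both sets of weights obey one recursion, whose coefficients are compared term by
-- term.

private
  variable
    n : ℕ

-- Nestings and crossings of arcs

module Arcs where
  open import Data.Nat using (_+_)
  open import Data.Nat.Properties hiding (_≟_; _<?_; _≤?_)
  open import Relation.Binary.PropositionalEquality using (refl; sym; trans; module ≡-Reasoning)
  open import Algebra.Properties.CommutativeMonoid.Sum ℕ.+-0-commutativeMonoid
    using (sum; sum-syntax; ∑-distrib-+; sum-replicate-zero)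

  private
    variable
      a b : Level
      A B : Set a

  ⟦_⟧ : Dec A → ℕ
  ⟦ d ⟧ = if does d then 1 else 0

  ⟦⟧-yes : (d : Dec A) → A → ⟦ d ⟧ ≡ 1
  ⟦⟧-yes (yes _) _ = refl
  ⟦⟧-yes (no ¬x) x = contradiction x ¬x

  ⟦⟧-no : (d : Dec A) → ¬ A → ⟦ d ⟧ ≡ 0
  ⟦⟧-no (yes x) ¬x = contradiction x ¬x
  ⟦⟧-no (no _)  _  = refl

  ⟦⟧-cong : (d : Dec A) (e : Dec B) → A ⇔ B → ⟦ d ⟧ ≡ ⟦ e ⟧
  ⟦⟧-cong d (yes y) A⇔B = ⟦⟧-yes d (from A⇔B y)
  ⟦⟧-cong d (no ¬y) A⇔B = ⟦⟧-no d (¬y ∘ to A⇔B)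

  #-sum : ∀ {ℓ} {P : Pred (Fin n) ℓ} (P? : Decidable P) → # P? ≡ ∑[ i < n ] ⟦ P? i ⟧
  #-sum P? = length-filter-tabulate P? id
    where
    length-filter-tabulate : ∀ {n ℓ} {P : Pred A ℓ} (P? : Decidable P) (f : Fin n → A) →
                             length (filter P? (tabulate f)) ≡ ∑[ i < n ] ⟦ P? (f i) ⟧
    length-filter-tabulate {n = zero}  P? f = refl
    length-filter-tabulate {n = suc n} P? f with P? (f zero)
    ... | yes _ = cong suc (length-filter-tabulate P? (f ∘ suc))
    ... | no  _ = length-filter-tabulate P? (f ∘ suc)

  sum-zero : (f : Fin n → ℕ) → (∀ i → f i ≡ 0) → sum f ≡ 0
  sum-zero {n} f f≗0 = trans (sum-cong-≗ f≗0) (sum-replicate-zero n)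

  sum-<-below : ∀ n k → k ≤ n → ∑[ i < n ] ⟦ toℕ i ℕ.<? k ⟧ ≡ k
  sum-<-below n zero k≤n = sum-zero {n} _ λ _ → refl
  sum-<-below (suc n) (suc k) (s≤s k≤n) = cong suc (trans
    (sum-cong-≗ {n} λ i → ⟦⟧-cong (suc (toℕ i) ℕ.<? suc k) (toℕ i ℕ.<? k) (mk⇔ s<s⁻¹ s<s))
    (sum-<-below n k k≤n))

  sum-between : ∀ n k l → k ≤ l → l ≤ n →
                ∑[ i < n ] ⟦ (k ℕ.≤? toℕ i) ×-dec (toℕ i ℕ.<? l) ⟧ ≡ l ∸ k
  sum-between n k l k≤l l≤n = begin
    ∑[ i < n ] between i                                  ≡⟨ ℕ.m+n∸m≡n k _ ⟨
    (k + ∑[ i < n ] between i) ∸ k                        ≡⟨ cong (λ m → (m + sum between) ∸ k) (sum-<-below n k (≤-trans k≤l l≤n)) ⟨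
    (∑[ i < n ] ⟦ toℕ i ℕ.<? k ⟧ + ∑[ i < n ] between i) ∸ k  ≡⟨ cong (_∸ k) (∑-distrib-+ {n} _ _) ⟨
    ∑[ i < n ] (⟦ toℕ i ℕ.<? k ⟧ + between i) ∸ k         ≡⟨ cong (_∸ k) (sum-cong-≗ {n} (split ∘ toℕ)) ⟩
    ∑[ i < n ] ⟦ toℕ i ℕ.<? l ⟧ ∸ k                       ≡⟨ cong (_∸ k) (sum-<-below n l l≤n) ⟩
    l ∸ k                                                 ∎
    where
    open ≡-Reasoning
    between : Fin n → ℕ
    between i = ⟦ (k ℕ.≤? toℕ i) ×-dec (toℕ i ℕ.<? l) ⟧
    split : ∀ m → ⟦ m ℕ.<? k ⟧ + ⟦ (k ℕ.≤? m) ×-dec (m ℕ.<? l) ⟧ ≡ ⟦ m ℕ.<? l ⟧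
    split m with m ℕ.<? k
    ... | yes m<k = trans (cong₂ _+_ (⟦⟧-yes (m ℕ.<? k) m<k) (⟦⟧-no ((k ℕ.≤? m) ×-dec (m ℕ.<? l)) (<⇒≱ m<k ∘ proj₁)))
                          (sym (⟦⟧-yes (m ℕ.<? l) (<-≤-trans m<k k≤l)))
    ... | no  m≮k = cong₂ _+_ (⟦⟧-no (m ℕ.<? k) m≮k)
                              (⟦⟧-cong ((k ℕ.≤? m) ×-dec (m ℕ.<? l)) (m ℕ.<? l) (mk⇔ proj₂ (≮⇒≥ m≮k ,_)))

  -- The graph of toℕ ∘ punchIn x.
  data Bump (x : ℕ) : ℕ → ℕ → Set where
    below : ∀ {i} → i < x → Bump x i i
    above : ∀ {i} → x ≤ i → Bump x i (suc i)

  punchIn-bump : (x : Fin (suc n)) (i : Fin n) → Bump (toℕ x) (toℕ i) (toℕ (punchIn x i))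
  punchIn-bump zero    i       = above z≤n
  punchIn-bump (suc x) zero    = below (s≤s z≤n)
  punchIn-bump (suc x) (suc i) = bump-suc (punchIn-bump x i)
    where
    bump-suc : ∀ {x i j} → Bump x i j → Bump (suc x) (suc i) (suc j)
    bump-suc (below i<x) = below (s<s i<x)
    bump-suc (above x≤i) = above (s≤s x≤i)

  private
    variable
      x i i′ j j′ s s′ t t′ v v′ : ℕ

  bump-≤ : Bump x i i′ → i ≤ i′
  bump-≤ (below _) = ≤-refl
  bump-≤ (above _) = n≤1+n _

  bump-< : Bump x i i′ → Bump x j j′ → i < j ⇔ i′ < j′
  bump-< (below i<x) (below j<x) = mk⇔ id id
  bump-< (below i<x) (above x≤j) = mk⇔ m<n⇒m<1+n (λ _ → <-≤-trans i<x x≤j)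
  bump-< (above x≤i) (below j<x) = mk⇔ (contradiction (<-≤-trans j<x x≤i) ∘ <-asym) (<-trans (n<1+n _))
  bump-< (above x≤i) (above x≤j) = mk⇔ s<s s<s⁻¹

  -- By trichotomy, equality is the failure of both strict comparisons.
  ≮≯⇔ : i < v ⇔ i′ < v′ → v < i ⇔ v′ < i′ → v ≡ i ⇔ v′ ≡ i′
  ≮≯⇔ lt gt = mk⇔
    (λ v≡i → ≤-antisym (≮⇒≥ (<-irrefl (sym v≡i) ∘ from lt)) (≮⇒≥ (<-irrefl v≡i ∘ from gt)))
    (λ v≡i → ≤-antisym (≮⇒≥ (<-irrefl (sym v≡i) ∘ to lt)) (≮⇒≥ (<-irrefl v≡i ∘ to gt)))

  -- The arc from position i to value s and the arc from position j to value t.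
  Nested Crossing : (i s j t : ℕ) → Set
  Nested   i s j t = (j < i × i < s × s < t) ⊎ (t < s × s ≤ i × i < j)
  Crossing i s j t = (j < i × i < t × t < s) ⊎ (s < t × t ≤ i × i < j)

  nested? : ∀ i s j t → Dec (Nested i s j t)
  nested? i s j t = (j ℕ.<? i ×-dec i ℕ.<? s ×-dec s ℕ.<? t) ⊎-dec (t ℕ.<? s ×-dec s ℕ.≤? i ×-dec i ℕ.<? j)

  crossing? : ∀ i s j t → Dec (Crossing i s j t)
  crossing? i s j t = (j ℕ.<? i ×-dec i ℕ.<? t ×-dec t ℕ.<? s) ⊎-dec (s ℕ.<? t ×-dec t ℕ.≤? i ×-dec i ℕ.<? j)

  nested-irrefl : ¬ Nested i s i s
  nested-irrefl (inj₁ (p , _)) = <-irrefl refl p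
  nested-irrefl (inj₂ (q , _)) = <-irrefl refl q

  crossing-irrefl : ¬ Crossing i s i s
  crossing-irrefl (inj₁ (p , _)) = <-irrefl refl p
  crossing-irrefl (inj₂ (q , _)) = <-irrefl refl q

  -- Comparisons between two positions or two values survive every insertion by `bump-<`. Only those
  -- between a position and a value need the hypothesis `compare`, which is available when a
  -- position below `b` meets a value not below `c`.
  module Embedding {b c x y : ℕ}
    (compare : ∀ {i i′ v v′} → (i < b → c ≤ v) → Bump x i i′ → Bump y v v′ → i < v ⇔ i′ < v′)
    (bi : Bump x i i′) (bs : Bump y s s′) (is : i < b → c ≤ s)
    (bj : Bump x j j′) (bt : Bump y t t′) (jt : j < b → c ≤ t)
    where

    compare-≤ : ∀ {i i′ v v′} → (i < b → c ≤ v) → Bump x i i′ → Bump y v v′ → v ≤ i ⇔ v′ ≤ i′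
    compare-≤ good bi bv = mk⇔ (λ v≤i → ≮⇒≥ (≤⇒≯ v≤i ∘ from (compare good bi bv)))
                               (λ v≤i → ≮⇒≥ (≤⇒≯ v≤i ∘ to (compare good bi bv)))

    nested-⇔ : Nested i s j t ⇔ Nested i′ s′ j′ t′
    nested-⇔ = mk⇔
      (λ { (inj₁ (p , q , r)) → inj₁ (to (bump-< bj bi) p , to (compare is bi bs) q , to (bump-< bs bt) r)
         ; (inj₂ (p , q , r)) → inj₂ (to (bump-< bt bs) p , to (compare-≤ is bi bs) q , to (bump-< bi bj) r) })
      (λ { (inj₁ (p , q , r)) → inj₁ (from (bump-< bj bi) p , from (compare is bi bs) q , from (bump-< bs bt) r)
         ; (inj₂ (p , q , r)) → inj₂ (from (bump-< bt bs) p , from (compare-≤ is bi bs) q , from (bump-< bi bj) r) })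

    -- Here `i` is compared with the value `t` of the other arc. The side condition for this mixed
    -- pair is inherited from the arc (j, t) if j < i, and from the arc (i, s) if s < t.
    crossing-⇔ : Crossing i s j t ⇔ Crossing i′ s′ j′ t′
    crossing-⇔ = mk⇔
      (λ { (inj₁ (p , q , r)) → inj₁ (to (bump-< bj bi) p , to (compare (upper p) bi bt) q , to (bump-< bt bs) r)
         ; (inj₂ (p , q , r)) → inj₂ (to (bump-< bs bt) p , to (compare-≤ (lower p) bi bt) q , to (bump-< bi bj) r) })
      (λ { (inj₁ (p , q , r)) → let j<i = from (bump-< bj bi) p in
                                inj₁ (j<i , from (compare (upper j<i) bi bt) q , from (bump-< bt bs) r)
         ; (inj₂ (p , q , r)) → let s<t = from (bump-< bs bt) p in
                                inj₂ (s<t , from (compare-≤ (lower s<t) bi bt) q , from (bump-< bi bj) r) })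
      where
      upper : j < i → i < b → c ≤ t
      upper j<i i<b = jt (<-trans j<i i<b)
      lower : s < t → i < b → c ≤ t
      lower s<t i<b = ≤-trans (is i<b) (<⇒≤ s<t)

  -- The arc removed runs from position x to a value y ≤ x; every earlier
  -- position is still open, i.e. has its value at x or later.
  module ClosingRow {x y : ℕ} (y≤x : y ≤ x) where

    compare : (i < x → x ≤ v) → Bump x i i′ → Bump y v v′ → i < v ⇔ i′ < v′
    compare unclosed (below i<x) (below v<y) = mk⇔ id id
    compare unclosed (below i<x) (above y≤v) = mk⇔ m<n⇒m<1+n (λ _ → <-≤-trans i<x (unclosed i<x))
    compare unclosed (above x≤i) (below v<y) =
      mk⇔ (contradiction (<-≤-trans v<y (≤-trans y≤x x≤i)) ∘ <-asym) (<-trans (n<1+n _))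
    compare unclosed (above x≤i) (above y≤v) = mk⇔ s<s s<s⁻¹

    compare-> : (i < x → x ≤ v) → Bump x i i′ → Bump y v v′ → v < i ⇔ v′ < i′
    compare-> unclosed (below i<x) (below v<y) = mk⇔ id id
    compare-> unclosed (below i<x) (above y≤v) =
      mk⇔ (contradiction (<-≤-trans i<x (unclosed i<x)) ∘ <-asym) (<-trans (n<1+n _))
    compare-> unclosed (above x≤i) (below v<y) = mk⇔ m<n⇒m<1+n (λ _ → <-≤-trans v<y (≤-trans y≤x x≤i))
    compare-> unclosed (above x≤i) (above y≤v) = mk⇔ s<s s<s⁻¹

    bump-open : (i < x → x ≤ v) → Bump x i i′ → Bump y v v′ → i′ < x → x ≤ v′
    bump-open unclosed bi bv i′<x = ≤-trans (unclosed (≤-<-trans (bump-≤ bi) i′<x)) (bump-≤ bv)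

    -- A value below `y` is also below `x`, so its position cannot be one of the open positions
    -- before `x`; the arc therefore starts beyond `x` and encloses the new one.
    nested-new : (i < x → x ≤ v) → Bump x i i′ → Bump y v v′ → Nested x y i′ v′ ⇔ v < y
    nested-new unclosed bi bv = mk⇔
      (λ { (inj₁ (_ , x<y , _)) → contradiction y≤x (<⇒≱ x<y)
         ; (inj₂ (v′<y , _)) → ≤-<-trans (bump-≤ bv) v′<y })
      (back unclosed bi bv)
      where
      back : (i < x → x ≤ v) → Bump x i i′ → Bump y v v′ → v < y → Nested x y i′ v′
      back unclosed (below i<x) _           v<y = contradiction (≤-trans y≤x (unclosed i<x)) (<⇒≱ v<y)
      back unclosed (above _)   (above y≤v) v<y = contradiction y≤v (<⇒≱ v<y)
      back unclosed (above x≤i) (below _)   v<y = inj₂ (v<y , y≤x , s≤s x≤i)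

    ¬nested-old : (i < x → x ≤ v) → Bump x i i′ → Bump y v v′ → ¬ Nested i′ v′ x y
    ¬nested-old unclosed bi bv (inj₁ (x<i′ , i′<v′ , v′<y)) = <⇒≱ (<-trans x<i′ (<-trans i′<v′ v′<y)) y≤x
    ¬nested-old unclosed bi bv (inj₂ (_ , v′≤i′ , i′<x)) =
      <⇒≱ i′<x (≤-trans (bump-open unclosed bi bv i′<x) v′≤i′)

    -- Again a value below `x` forces the position beyond `x`. Inserting `y` moves `v` to v + 1,
    -- which turns the half-open range from `y` to `x` into y < v + 1 ≤ x.
    crossing-new : (i < x → x ≤ v) → Bump x i i′ → Bump y v v′ → Crossing x y i′ v′ ⇔ (y ≤ v × v < x)
    crossing-new unclosed bi bv = mk⇔
      (λ { (inj₁ (_ , x<v′ , v′<y)) → contradiction y≤x (<⇒≱ (<-trans x<v′ v′<y))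
         ; (inj₂ (y<v′ , v′≤x , _)) → forth bv y<v′ v′≤x })
      (back unclosed bi bv)
      where
      forth : Bump y v v′ → y < v′ → v′ ≤ x → y ≤ v × v < x
      forth (below v<y) y<v′ v′≤x = contradiction y<v′ (<-asym v<y)
      forth (above y≤v) y<v′ v′≤x = y≤v , v′≤x
      back : (i < x → x ≤ v) → Bump x i i′ → Bump y v v′ → y ≤ v × v < x → Crossing x y i′ v′
      back unclosed (below i<x) _           (_   , v<x) = contradiction (unclosed i<x) (<⇒≱ v<x)
      back unclosed (above _)   (below v<y) (y≤v , _)   = contradiction y≤v (<⇒≱ v<y)
      back unclosed (above x≤i) (above _)   (y≤v , v<x) = inj₂ (s≤s y≤v , v<x , s≤s x≤i)

    ¬crossing-old : (i < x → x ≤ v) → Bump x i i′ → Bump y v v′ → ¬ Crossing i′ v′ x y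
    ¬crossing-old unclosed bi bv (inj₁ (x<i′ , i′<y , _)) = <⇒≱ (<-trans x<i′ i′<y) y≤x
    ¬crossing-old unclosed bi bv (inj₂ (v′<y , _ , i′<x)) =
      <⇒≱ v′<y (≤-trans y≤x (bump-open unclosed bi bv i′<x))

  -- The arc removed runs from an open position x ≤ g to the value suc g; of the
  -- remaining positions the first g are open, and position g is suc g moved down.
  module ClosingColumn {x g : ℕ} (x≤g : x ≤ g) where

    compare : (i < g → g < v) → Bump x i i′ → Bump (suc g) v v′ → i < v ⇔ i′ < v′
    compare unclosed (below i<x) (below v≤g) = mk⇔ id id
    compare unclosed (below i<x) (above g<v) = mk⇔ m<n⇒m<1+n (λ _ → <-trans (<-≤-trans i<x x≤g) g<v)
    compare unclosed (above x≤i) (below v≤g) =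
      mk⇔ (λ i<v → contradiction (unclosed (<-≤-trans i<v (s≤s⁻¹ v≤g))) (≤⇒≯ (s≤s⁻¹ v≤g)))
          (<-trans (n<1+n _))
    compare unclosed (above x≤i) (above g<v) = mk⇔ s<s s<s⁻¹

    -- Position `g` moves up to `suc g` while value `g` stays, so a fixed point `g` would become an
    -- arc to the left. At any other position before `suc g` openness excludes this.
    compare-> : i ≢ g → (i < g → g < v) → Bump x i i′ → Bump (suc g) v v′ → v < i ⇔ v′ < i′
    compare-> i≢g unclosed (below i<x) (below v≤g) = mk⇔ id id
    compare-> i≢g unclosed (below i<x) (above g<v) =
      mk⇔ (contradiction (<-trans (<-≤-trans i<x x≤g) g<v) ∘ <-asym) (<-trans (n<1+n _))
    compare-> {i} {v} i≢g unclosed (above x≤i) (below v≤g) =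
      mk⇔ m<n⇒m<1+n (λ v≤i → ≤∧≢⇒< (s≤s⁻¹ v≤i) v≢i)
      where
      v≢i : v ≢ i
      v≢i refl = <⇒≱ (unclosed (≤∧≢⇒< (s≤s⁻¹ v≤g) i≢g)) (s≤s⁻¹ v≤g)
    compare-> i≢g unclosed (above x≤i) (above g<v) = mk⇔ s<s s<s⁻¹

    bump-open : (i < g → g < v) → Bump x i i′ → Bump (suc g) v v′ → i′ < g → g < v′
    bump-open unclosed bi bv i′<g = <-≤-trans (unclosed (≤-<-trans (bump-≤ bi) i′<g)) (bump-≤ bv)

    bump-value : Bump (suc g) v v′ → g < v → suc g < v′
    bump-value (below v≤g) g<v = contradiction (s≤s⁻¹ v≤g) (<⇒≱ g<v)
    bump-value (above _)   g<v = s<s g<v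

    -- A position before `x` is open, so its arc ends beyond `suc g` and covers the new arc.
    nested-new : (i < g → g < v) → Bump x i i′ → Bump (suc g) v v′ → Nested x (suc g) i′ v′ ⇔ i < x
    nested-new unclosed bi bv = mk⇔
      (λ { (inj₁ (i′<x , _)) → ≤-<-trans (bump-≤ bi) i′<x
         ; (inj₂ (_ , g<x , _)) → contradiction x≤g (<⇒≱ g<x) })
      (back unclosed bi bv)
      where
      back : (i < g → g < v) → Bump x i i′ → Bump (suc g) v v′ → i < x → Nested x (suc g) i′ v′
      back unclosed (above x≤i) bv i<x = contradiction x≤i (<⇒≱ i<x)
      back unclosed (below _)   bv i<x =
        inj₁ (i<x , s≤s x≤g , bump-value bv (unclosed (<-≤-trans i<x x≤g)))

    ¬nested-old : (i < g → g < v) → Bump x i i′ → Bump (suc g) v v′ → ¬ Nested i′ v′ x (suc g)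
    ¬nested-old unclosed bi bv (inj₁ (_ , i′<v′ , v′≤g)) =
      <⇒≱ (bump-open unclosed bi bv (<-≤-trans i′<v′ (s≤s⁻¹ v′≤g))) (s≤s⁻¹ v′≤g)
    ¬nested-old unclosed bi bv (inj₂ (g<v′ , v′≤i′ , i′<x)) =
      <⇒≱ (<-trans (n<1+n g) g<v′) (≤-trans v′≤i′ (≤-trans (<⇒≤ i′<x) x≤g))

    ¬crossing-new : (i < g → g < v) → Bump x i i′ → Bump (suc g) v v′ → ¬ Crossing x (suc g) i′ v′
    ¬crossing-new unclosed bi bv (inj₁ (i′<x , _ , v′≤g)) =
      <⇒≱ (bump-open unclosed bi bv (<-≤-trans i′<x x≤g)) (s≤s⁻¹ v′≤g)
    ¬crossing-new unclosed bi bv (inj₂ (g<v′ , v′≤x , _)) = <⇒≱ (<-trans (n<1+n g) g<v′) (≤-trans v′≤x x≤g)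

    -- A crossing of two arcs to the right is charged to the one that starts later. The new arc ends
    -- before all the open ones, so it is crossed by exactly those that start after `x`, and the
    -- charge is theirs.
    crossing-old : (i < g → g < v) → Bump x i i′ → Bump (suc g) v v′ →
                   Crossing i′ v′ x (suc g) ⇔ (x ≤ i × i < g)
    crossing-old unclosed bi bv = mk⇔
      (λ { (inj₁ (x<i′ , i′≤g , _)) → forth bi x<i′ i′≤g
         ; (inj₂ (_ , g<i′ , i′<x)) → contradiction x≤g (<⇒≱ (<-trans g<i′ i′<x)) })
      (back unclosed bi bv)
      where
      forth : Bump x i i′ → x < i′ → i′ < suc g → x ≤ i × i < g
      forth (below i<x) x<i′ i′≤g = contradiction x<i′ (<-asym i<x)
      forth (above x≤i) x<i′ i′≤g = x≤i , s<s⁻¹ i′≤g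
      back : (i < g → g < v) → Bump x i i′ → Bump (suc g) v v′ → x ≤ i × i < g → Crossing i′ v′ x (suc g)
      back unclosed (below i<x) bv (x≤i , _)   = contradiction x≤i (<⇒≱ i<x)
      back unclosed (above _)   bv (x≤i , i<g) = inj₁ (s≤s x≤i , s<s i<g , bump-value bv (unclosed i<g))

-- The statistics of a permutation after insertion of an arc

module Statistics where
  open Arcs
  open import Data.Nat using (_+_)
  open import Data.Nat.Properties hiding (_≟_; _<?_; _≤?_)
  open import Relation.Binary.PropositionalEquality using (refl; sym; trans; module ≡-Reasoning)
  open import Algebra.Properties.CommutativeMonoid.Sum ℕ.+-0-commutativeMonoid
    using (sum; sum-syntax; sum-remove; sum-permute; ∑-distrib-+)

  val : Permutation′ n → Fin n → ℕ
  val σ i = toℕ (σ ⟨$⟩ʳ i)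

  insert-self : ∀ x y (π : Permutation′ n) → insert x y π ⟨$⟩ʳ x ≡ y
  insert-self x y π rewrite proj₂ (dec-yes (x Fin.≟ x) refl) = refl

  insert-selfˡ : ∀ x y (π : Permutation′ n) → insert x y π ⟨$⟩ˡ y ≡ x
  insert-selfˡ x y π = trans (cong (insert x y π ⟨$⟩ˡ_) (sym (insert-self x y π))) (inverseˡ (insert x y π))

  insert-punchInˡ : ∀ x y (π : Permutation′ n) v → insert x y π ⟨$⟩ˡ punchIn y v ≡ punchIn x (π ⟨$⟩ˡ v)
  insert-punchInˡ x y π v = begin
    τ ⟨$⟩ˡ punchIn y v                      ≡⟨ cong (λ w → τ ⟨$⟩ˡ punchIn y w) (inverseʳ π) ⟨
    τ ⟨$⟩ˡ punchIn y (π ⟨$⟩ʳ (π ⟨$⟩ˡ v))      ≡⟨ cong (τ ⟨$⟩ˡ_) (insert-punchIn x y π (π ⟨$⟩ˡ v)) ⟨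
    τ ⟨$⟩ˡ (τ ⟨$⟩ʳ punchIn x (π ⟨$⟩ˡ v))      ≡⟨ inverseˡ τ ⟩
    punchIn x (π ⟨$⟩ˡ v)                    ∎
    where
    open ≡-Reasoning
    τ = insert x y π

  sum-insert : ∀ x y (π : Permutation′ n) (f : ℕ → ℕ → ℕ) →
               ∑[ i < suc n ] f (toℕ i) (val (insert x y π) i) ≡
               f (toℕ x) (toℕ y) + ∑[ i < n ] f (toℕ (punchIn x i)) (toℕ (punchIn y (π ⟨$⟩ʳ i)))
  sum-insert {n} x y π f = trans (sum-remove {n} {x} (λ i → f (toℕ i) (val (insert x y π) i)))
    (cong₂ _+_ (cong (f (toℕ x) ∘ toℕ) (insert-self x y π))
               (sum-cong-≗ {n} λ i → cong (f (toℕ (punchIn x i)) ∘ toℕ) (insert-punchIn x y π i)))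

  pairs : (ℕ → ℕ → ℕ → ℕ → ℕ) → Permutation′ n → ℕ
  pairs {n} F σ = ∑[ i < n ] ∑[ j < n ] F (toℕ i) (val σ i) (toℕ j) (val σ j)

  -- Splitting off `x` in both indices leaves the new arc against itself, against every old arc in
  -- the two orders, and the pairs of old arcs.
  pairs-insert : ∀ x y (π : Permutation′ n) F (new : Fin n → ℕ) →
    let i′ = λ i → toℕ (punchIn x i)
        s′ = λ i → toℕ (punchIn y (π ⟨$⟩ʳ i))
    in F (toℕ x) (toℕ y) (toℕ x) (toℕ y) ≡ 0 →
       (∀ i → F (toℕ x) (toℕ y) (i′ i) (s′ i) + F (i′ i) (s′ i) (toℕ x) (toℕ y) ≡ new i) →
       (∀ i j → F (i′ i) (s′ i) (i′ j) (s′ j) ≡ F (toℕ i) (val π i) (toℕ j) (val π j)) →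
       pairs F (insert x y π) ≡ sum new + pairs F π
  pairs-insert {n} x y π F new self≡0 new≡ old≡ = begin
    ∑[ i < suc n ] ∑[ j < suc n ] F (toℕ i) (val τ i) (toℕ j) (val τ j)
      ≡⟨ sum-cong-≗ {suc n} (λ i → sum-insert x y π (F (toℕ i) (val τ i))) ⟩
    ∑[ i < suc n ] rest (toℕ i) (val τ i)
      ≡⟨ sum-insert x y π rest ⟩
    rest (toℕ x) (toℕ y) + ∑[ i < n ] rest (i′ i) (s′ i)
      ≡⟨ cong₂ _+_ (cong (_+ sum outgoing) self≡0) (∑-distrib-+ incoming (λ i → sum (old i))) ⟩
    sum outgoing + (sum incoming + ∑[ i < n ] sum (old i))
      ≡⟨ ℕ.+-assoc (sum outgoing) (sum incoming) (∑[ i < n ] sum (old i)) ⟨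
    sum outgoing + sum incoming + ∑[ i < n ] sum (old i)
      ≡⟨ cong₂ _+_ (trans (sym (∑-distrib-+ outgoing incoming)) (sum-cong-≗ new≡))
                   (sum-cong-≗ {n} λ i → sum-cong-≗ (old≡ i)) ⟩
    sum new + pairs F π ∎
    where
    open ≡-Reasoning
    τ = insert x y π
    i′ s′ : Fin n → ℕ
    i′ i = toℕ (punchIn x i)
    s′ i = toℕ (punchIn y (π ⟨$⟩ʳ i))
    outgoing incoming : Fin n → ℕ
    outgoing i = F (toℕ x) (toℕ y) (i′ i) (s′ i)
    incoming i = F (i′ i) (s′ i) (toℕ x) (toℕ y)
    old : Fin n → Fin n → ℕ
    old i j = F (i′ i) (s′ i) (i′ j) (s′ j)
    rest : ℕ → ℕ → ℕ
    rest i s = F i s (toℕ x) (toℕ y) + ∑[ j < n ] F i s (i′ j) (s′ j)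

  nest-pairs : (σ : Permutation′ n) → nest σ ≡ pairs (λ i s j t → ⟦ nested? i s j t ⟧) σ
  nest-pairs {n} σ = sum-cong-≗ {n} λ i → #-sum {n} _

  cros-pairs : (σ : Permutation′ n) → cros σ ≡ pairs (λ i s j t → ⟦ crossing? i s j t ⟧) σ
  cros-pairs {n} σ = sum-cong-≗ {n} λ i → #-sum {n} _

  exc-sum : (σ : Permutation′ n) → exc σ ≡ ∑[ i < n ] ⟦ toℕ i ℕ.<? val σ i ⟧
  exc-sum {n} σ = #-sum {n} _

  fix-sum : (σ : Permutation′ n) → fix σ ≡ ∑[ i < n ] ⟦ val σ i ℕ.≟ toℕ i ⟧
  fix-sum {n} σ = trans (#-sum {n} _)
    (sum-cong-≗ {n} λ i → ⟦⟧-cong (σ ⟨$⟩ʳ i Fin.≟ i) (val σ i ℕ.≟ toℕ i) (mk⇔ (cong toℕ) Fin.toℕ-injective))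

  cpk? : (σ : Permutation′ n) (x : Fin n) → Dec (toℕ (σ ⟨$⟩ˡ x) < toℕ x × val σ x < toℕ x)
  cpk? σ x = (toℕ (σ ⟨$⟩ˡ x) ℕ.<? toℕ x) ×-dec (val σ x ℕ.<? toℕ x)

  cpk-sum : (σ : Permutation′ n) → cpk σ ≡ ∑[ x < n ] ⟦ cpk? σ x ⟧
  cpk-sum {n} σ = #-sum {n} _

  -- The upper left `b` by `c` corner of the permutation matrix is empty.
  Avoids : ℕ → ℕ → Permutation′ n → Set
  Avoids b c σ = ∀ i → toℕ i < b → c ≤ val σ i

  bump-above : ∀ {x i i′} → x ≤ i → Bump x i i′ → i′ ≡ suc i
  bump-above x≤i (below i<x) = contradiction x≤i (<⇒≱ i<x)
  bump-above x≤i (above _)   = refl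

  bump-below : ∀ {x i i′} → i < x → Bump x i i′ → i′ ≡ i
  bump-below i<x (below _)   = refl
  bump-below i<x (above x≤i) = contradiction x≤i (<⇒≱ i<x)

  bump-strict : ∀ {x i i′} → x < i′ → Bump x i i′ → i < i′
  bump-strict x<i (below i<x) = contradiction x<i (<-asym i<x)
  bump-strict _   (above _)   = n<1+n _

  -- Cyclic peaks use one label both as a position and as a value. Beyond both holes the two
  -- renumberings agree, so such a label keeps its double role.
  punchIn-above : ∀ (x y : Fin (suc n)) v → toℕ x ≤ toℕ v → toℕ y ≤ toℕ v → punchIn x v ≡ punchIn y v
  punchIn-above x y v x≤v y≤v = Fin.toℕ-injective
    (trans (bump-above x≤v (punchIn-bump x v)) (sym (bump-above y≤v (punchIn-bump y v))))

  sum-values : (π : Permutation′ n) (f : ℕ → ℕ) → ∑[ i < n ] f (val π i) ≡ ∑[ v < n ] f (toℕ v)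
  sum-values {n} π f = sym (sum-permute (f ∘ toℕ) π)

  avoids-position : ∀ {b c} (π : Permutation′ n) → Avoids b c π → ∀ v → toℕ (π ⟨$⟩ˡ v) < b → c ≤ toℕ v
  avoids-position {c = c} π avoids v p<b = subst (λ w → c ≤ toℕ w) (inverseʳ π) (avoids (π ⟨$⟩ˡ v) p<b)

  module InsertRow (x y : Fin (suc n)) (y≤x : toℕ y ≤ toℕ x)
                   (π : Permutation′ n) (avoids : Avoids (toℕ x) (toℕ x) π) where
    open ClosingRow y≤x
    open ≡-Reasoning

    private
      τ = insert x y π
      i′ s′ : Fin n → ℕ
      i′ i = toℕ (punchIn x i)
      s′ i = toℕ (punchIn y (π ⟨$⟩ʳ i))
      bi : ∀ i → Bump (toℕ x) (toℕ i) (i′ i)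
      bi i = punchIn-bump x i
      bs : ∀ i → Bump (toℕ y) (val π i) (s′ i)
      bs i = punchIn-bump y (π ⟨$⟩ʳ i)
      module E i j = Embedding compare (bi i) (bs i) (avoids i) (bi j) (bs j) (avoids j)

    -- The arcs that enclose the new one are those with a value below `y`, and a bijection takes
    -- each of these `toℕ y` values once.
    nest-insert : nest τ ≡ toℕ y + nest π
    nest-insert = begin
      nest τ                                                           ≡⟨ nest-pairs τ ⟩
      pairs (λ i s j t → ⟦ nested? i s j t ⟧) τ
        ≡⟨ pairs-insert x y π (λ i s j t → ⟦ nested? i s j t ⟧) (λ i → ⟦ val π i ℕ.<? toℕ y ⟧)
             (⟦⟧-no (nested? (toℕ x) (toℕ y) (toℕ x) (toℕ y)) nested-irrefl)
             (λ i → trans (cong₂ _+_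
               (⟦⟧-cong (nested? (toℕ x) (toℕ y) (i′ i) (s′ i)) (val π i ℕ.<? toℕ y)
                        (nested-new (avoids i) (bi i) (bs i)))
               (⟦⟧-no (nested? (i′ i) (s′ i) (toℕ x) (toℕ y)) (¬nested-old (avoids i) (bi i) (bs i))))
               (+-identityʳ _))
             (λ i j → sym (⟦⟧-cong (nested? (toℕ i) (val π i) (toℕ j) (val π j))
                                   (nested? (i′ i) (s′ i) (i′ j) (s′ j)) (E.nested-⇔ i j))) ⟩
      ∑[ i < n ] ⟦ val π i ℕ.<? toℕ y ⟧ + pairs (λ i s j t → ⟦ nested? i s j t ⟧) π
        ≡⟨ cong₂ _+_ (trans (sum-values π (λ v → ⟦ v ℕ.<? toℕ y ⟧)) (sum-<-below n (toℕ y) (s≤s⁻¹ (toℕ<n y))))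
                     (sym (nest-pairs π)) ⟩
      toℕ y + nest π ∎

    cros-insert : cros τ ≡ toℕ x ∸ toℕ y + cros π
    cros-insert = begin
      cros τ                                                           ≡⟨ cros-pairs τ ⟩
      pairs (λ i s j t → ⟦ crossing? i s j t ⟧) τ
        ≡⟨ pairs-insert x y π (λ i s j t → ⟦ crossing? i s j t ⟧) (λ i → new (val π i))
             (⟦⟧-no (crossing? (toℕ x) (toℕ y) (toℕ x) (toℕ y)) crossing-irrefl)
             (λ i → trans (cong₂ _+_
               (⟦⟧-cong (crossing? (toℕ x) (toℕ y) (i′ i) (s′ i)) ((toℕ y ℕ.≤? val π i) ×-dec (val π i ℕ.<? toℕ x))
                        (crossing-new (avoids i) (bi i) (bs i)))
               (⟦⟧-no (crossing? (i′ i) (s′ i) (toℕ x) (toℕ y)) (¬crossing-old (avoids i) (bi i) (bs i))))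
               (+-identityʳ _))
             (λ i j → sym (⟦⟧-cong (crossing? (toℕ i) (val π i) (toℕ j) (val π j))
                                   (crossing? (i′ i) (s′ i) (i′ j) (s′ j)) (E.crossing-⇔ i j))) ⟩
      ∑[ i < n ] new (val π i) + pairs (λ i s j t → ⟦ crossing? i s j t ⟧) π
        ≡⟨ cong₂ _+_ (trans (sum-values π new) (sum-between n (toℕ y) (toℕ x) y≤x (s≤s⁻¹ (toℕ<n x))))
                     (sym (cros-pairs π)) ⟩
      toℕ x ∸ toℕ y + cros π ∎
      where
      new : ℕ → ℕ
      new v = ⟦ (toℕ y ℕ.≤? v) ×-dec (v ℕ.<? toℕ x) ⟧

    exc-insert : exc τ ≡ exc π
    exc-insert = begin
      exc τ                                               ≡⟨ exc-sum τ ⟩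
      ∑[ i < suc n ] ⟦ toℕ i ℕ.<? val τ i ⟧               ≡⟨ sum-insert x y π (λ i s → ⟦ i ℕ.<? s ⟧) ⟩
      ⟦ toℕ x ℕ.<? toℕ y ⟧ + ∑[ i < n ] ⟦ i′ i ℕ.<? s′ i ⟧
        ≡⟨ cong₂ _+_ (⟦⟧-no (toℕ x ℕ.<? toℕ y) (≤⇒≯ y≤x))
                     (sum-cong-≗ {n} λ i → sym (⟦⟧-cong (toℕ i ℕ.<? val π i) (i′ i ℕ.<? s′ i)
                                                        (compare (avoids i) (bi i) (bs i)))) ⟩
      ∑[ i < n ] ⟦ toℕ i ℕ.<? val π i ⟧                   ≡⟨ exc-sum π ⟨
      exc π                                               ∎

    fix-insert : fix τ ≡ ⟦ toℕ y ℕ.≟ toℕ x ⟧ + fix π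
    fix-insert = begin
      fix τ                                               ≡⟨ fix-sum τ ⟩
      ∑[ i < suc n ] ⟦ val τ i ℕ.≟ toℕ i ⟧                ≡⟨ sum-insert x y π (λ i s → ⟦ s ℕ.≟ i ⟧) ⟩
      ⟦ toℕ y ℕ.≟ toℕ x ⟧ + ∑[ i < n ] ⟦ s′ i ℕ.≟ i′ i ⟧
        ≡⟨ cong (⟦ toℕ y ℕ.≟ toℕ x ⟧ +_)
             (trans (sum-cong-≗ {n} λ i → sym (⟦⟧-cong (val π i ℕ.≟ toℕ i) (s′ i ℕ.≟ i′ i)
                      (≮≯⇔ (compare (avoids i) (bi i) (bs i)) (compare-> (avoids i) (bi i) (bs i)))))
                    (sym (fix-sum π))) ⟩
      ⟦ toℕ y ℕ.≟ toℕ x ⟧ + fix π                         ∎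

    -- The label `x` is no peak: the value `x` is taken at `x` itself, or else at a later position,
    -- because the earlier ones are open. A label below `x` is an open position, whose value is not
    -- smaller. Labels from `x` on are shifted alike as positions and as values.
    cpk-insert : cpk τ ≡ cpk π
    cpk-insert = begin
      cpk τ                                               ≡⟨ cpk-sum τ ⟩
      ∑[ v < suc n ] ⟦ cpk? τ v ⟧                         ≡⟨ sum-remove {n} {x} (λ v → ⟦ cpk? τ v ⟧) ⟩
      ⟦ cpk? τ x ⟧ + ∑[ v < n ] ⟦ cpk? τ (punchIn x v) ⟧
        ≡⟨ cong₂ _+_ (⟦⟧-no (cpk? τ x) ¬peak)
                     (sum-cong-≗ {n} λ v → ⟦⟧-cong (cpk? τ (punchIn x v)) (cpk? π v) (peak-⇔ v)) ⟩
      ∑[ v < n ] ⟦ cpk? π v ⟧                             ≡⟨ cpk-sum π ⟨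
      cpk π                                               ∎
      where
      ¬peak : ¬ (toℕ (τ ⟨$⟩ˡ x) < toℕ x × val τ x < toℕ x)
      ¬peak (x<x , _) = position≮x (y Fin.≟ x) x<x
        where
        position≮x : Dec (y ≡ x) → ¬ toℕ (τ ⟨$⟩ˡ x) < toℕ x
        position≮x (yes y≡x) p = <-irrefl (cong toℕ (trans (cong (τ ⟨$⟩ˡ_) (sym y≡x)) (insert-selfˡ x y π))) p
        position≮x (no  y≢x) p = <⇒≱ (bump-strict (≤∧≢⇒< y≤x (y≢x ∘ Fin.toℕ-injective)) bump-v)
                                     (avoids-position π avoids v position-v)
          where
          v = punchOut y≢x
          -- In `π` the value `x` of `τ` has the label x - 1, which is too small for an open
          -- position.
          bump-v : Bump (toℕ y) (toℕ v) (toℕ x)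
          bump-v = subst (Bump (toℕ y) (toℕ v) ∘ toℕ) (Fin.punchIn-punchOut y≢x) (punchIn-bump y v)
          position-v : toℕ (π ⟨$⟩ˡ v) < toℕ x
          position-v = ≤-<-trans (bump-≤ (bi (π ⟨$⟩ˡ v)))
            (subst (λ w → toℕ w < toℕ x)
                   (trans (cong (τ ⟨$⟩ˡ_) (sym (Fin.punchIn-punchOut y≢x))) (insert-punchInˡ x y π v)) p)
      peak-⇔ : ∀ v → (toℕ (τ ⟨$⟩ˡ punchIn x v) < toℕ (punchIn x v) × val τ (punchIn x v) < toℕ (punchIn x v)) ⇔
                     (toℕ (π ⟨$⟩ˡ v) < toℕ v × val π v < toℕ v)
      peak-⇔ v with toℕ v ℕ.<? toℕ x
      ... | yes v<x = mk⇔
        (λ { (_ , w<v) → contradiction w<v (≤⇒≯ (≤-trans (≤-reflexive (bump-below v<x (bi v)))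
               (≤-trans (<⇒≤ v<x) (≤-trans (avoids v v<x) (≤-trans (bump-≤ (bs v))
                 (≤-reflexive (cong toℕ (sym (insert-punchIn x y π v)))))))))  })
        (λ { (_ , w<v) → contradiction w<v (≤⇒≯ (≤-trans (<⇒≤ v<x) (avoids v v<x))) })
      ... | no v≮x = mk⇔
        (λ { (q , w) → subst (toℕ p <_) (cong toℕ (inverseʳ π)) (from (compare (avoids p) (bi p) (bs p)) (subst₂ _<_ p≡ v≡ q))
                     , from (compare-> (avoids v) (bi v) (bs v)) (subst (_< i′ v) w≡ w) })
        (λ { (q , w) → subst₂ _<_ (sym p≡) (sym v≡)
                         (to (compare (avoids p) (bi p) (bs p)) (subst (toℕ p <_) (cong toℕ (sym (inverseʳ π))) q))
                     , subst (_< i′ v) (sym w≡) (to (compare-> (avoids v) (bi v) (bs v)) w) })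
        where
        p = π ⟨$⟩ˡ v
        x≤v = ≮⇒≥ v≮x
        punchIn≡ : punchIn x v ≡ punchIn y v
        punchIn≡ = punchIn-above x y v x≤v (≤-trans y≤x x≤v)
        p≡ : toℕ (τ ⟨$⟩ˡ punchIn x v) ≡ i′ p
        p≡ = cong toℕ (trans (cong (τ ⟨$⟩ˡ_) punchIn≡) (insert-punchInˡ x y π v))
        v≡ : toℕ (punchIn x v) ≡ s′ p
        v≡ = cong toℕ (trans punchIn≡ (cong (punchIn y) (sym (inverseʳ π))))
        w≡ : val τ (punchIn x v) ≡ s′ v
        w≡ = cong toℕ (insert-punchIn x y π v)

  bump-≤⇔ : ∀ {g v v′} → Bump (suc g) v v′ → v′ < suc g ⇔ v ≤ g
  bump-≤⇔ (below v≤g) = mk⇔ s≤s⁻¹ s≤s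
  bump-≤⇔ (above g<v) = mk⇔ (λ v<g → contradiction (<-trans (n<1+n _) v<g) (≤⇒≯ g<v))
                            (λ v≤g → contradiction v≤g (<⇒≱ g<v))

  module InsertColumn (x : Fin (suc (suc n))) (g : Fin (suc n)) (x≤g : toℕ x ≤ toℕ g)
                      (π : Permutation′ (suc n)) (avoids : Avoids (toℕ g) (suc (toℕ g)) π) where
    open ClosingColumn x≤g
    open ≡-Reasoning

    private
      h = suc g
      τ = insert x h π
      i′ s′ : Fin (suc n) → ℕ
      i′ i = toℕ (punchIn x i)
      s′ i = toℕ (punchIn h (π ⟨$⟩ʳ i))
      bi : ∀ i → Bump (toℕ x) (toℕ i) (i′ i)
      bi i = punchIn-bump x i
      bs : ∀ i → Bump (toℕ h) (val π i) (s′ i)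
      bs i = punchIn-bump h (π ⟨$⟩ʳ i)
      module E i j = Embedding compare (bi i) (bs i) (avoids i) (bi j) (bs j) (avoids j)
      x<1+n : toℕ x < suc n
      x<1+n = ≤-<-trans x≤g (toℕ<n g)

    nest-insert : nest τ ≡ toℕ x + nest π
    nest-insert = begin
      nest τ                                                           ≡⟨ nest-pairs τ ⟩
      pairs (λ i s j t → ⟦ nested? i s j t ⟧) τ
        ≡⟨ pairs-insert x h π (λ i s j t → ⟦ nested? i s j t ⟧) (λ i → ⟦ toℕ i ℕ.<? toℕ x ⟧)
             (⟦⟧-no (nested? (toℕ x) (toℕ h) (toℕ x) (toℕ h)) nested-irrefl)
             (λ i → trans (cong₂ _+_
               (⟦⟧-cong (nested? (toℕ x) (toℕ h) (i′ i) (s′ i)) (toℕ i ℕ.<? toℕ x)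
                        (nested-new (avoids i) (bi i) (bs i)))
               (⟦⟧-no (nested? (i′ i) (s′ i) (toℕ x) (toℕ h)) (¬nested-old (avoids i) (bi i) (bs i))))
               (+-identityʳ _))
             (λ i j → sym (⟦⟧-cong (nested? (toℕ i) (val π i) (toℕ j) (val π j))
                                   (nested? (i′ i) (s′ i) (i′ j) (s′ j)) (E.nested-⇔ i j))) ⟩
      ∑[ i < suc n ] ⟦ toℕ i ℕ.<? toℕ x ⟧ + pairs (λ i s j t → ⟦ nested? i s j t ⟧) π
        ≡⟨ cong₂ _+_ (sum-<-below (suc n) (toℕ x) (<⇒≤ x<1+n)) (sym (nest-pairs π)) ⟩
      toℕ x + nest π ∎

    cros-insert : cros τ ≡ toℕ g ∸ toℕ x + cros π
    cros-insert = begin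
      cros τ                                                           ≡⟨ cros-pairs τ ⟩
      pairs (λ i s j t → ⟦ crossing? i s j t ⟧) τ
        ≡⟨ pairs-insert x h π (λ i s j t → ⟦ crossing? i s j t ⟧) new
             (⟦⟧-no (crossing? (toℕ x) (toℕ h) (toℕ x) (toℕ h)) crossing-irrefl)
             (λ i → cong₂ _+_
               (⟦⟧-no (crossing? (toℕ x) (toℕ h) (i′ i) (s′ i)) (¬crossing-new (avoids i) (bi i) (bs i)))
               (⟦⟧-cong (crossing? (i′ i) (s′ i) (toℕ x) (toℕ h)) ((toℕ x ℕ.≤? toℕ i) ×-dec (toℕ i ℕ.<? toℕ g))
                        (crossing-old (avoids i) (bi i) (bs i))))
             (λ i j → sym (⟦⟧-cong (crossing? (toℕ i) (val π i) (toℕ j) (val π j))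
                                   (crossing? (i′ i) (s′ i) (i′ j) (s′ j)) (E.crossing-⇔ i j))) ⟩
      sum new + pairs (λ i s j t → ⟦ crossing? i s j t ⟧) π
        ≡⟨ cong₂ _+_ (sum-between (suc n) (toℕ x) (toℕ g) x≤g (<⇒≤ (toℕ<n g))) (sym (cros-pairs π)) ⟩
      toℕ g ∸ toℕ x + cros π ∎
      where
      new : Fin (suc n) → ℕ
      new i = ⟦ (toℕ x ℕ.≤? toℕ i) ×-dec (toℕ i ℕ.<? toℕ g) ⟧

    exc-insert : exc τ ≡ suc (exc π)
    exc-insert = begin
      exc τ                                               ≡⟨ exc-sum τ ⟩
      ∑[ i < suc (suc n) ] ⟦ toℕ i ℕ.<? val τ i ⟧         ≡⟨ sum-insert x h π (λ i s → ⟦ i ℕ.<? s ⟧) ⟩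
      ⟦ toℕ x ℕ.<? toℕ h ⟧ + ∑[ i < suc n ] ⟦ i′ i ℕ.<? s′ i ⟧
        ≡⟨ cong₂ _+_ (⟦⟧-yes (toℕ x ℕ.<? toℕ h) (s≤s x≤g))
                     (sum-cong-≗ {suc n} λ i → sym (⟦⟧-cong (toℕ i ℕ.<? val π i) (i′ i ℕ.<? s′ i)
                                                            (compare (avoids i) (bi i) (bs i)))) ⟩
      suc (∑[ i < suc n ] ⟦ toℕ i ℕ.<? val π i ⟧)         ≡⟨ cong suc (exc-sum π) ⟨
      suc (exc π)                                         ∎

    -- A fixed point g of π is an arc from suc g to g in τ.
    fix-insert : fix π ≡ ⟦ val π g ℕ.≟ toℕ g ⟧ + fix τ
    fix-insert = begin
      fix π                                               ≡⟨ fix-sum π ⟩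
      ∑[ i < suc n ] ⟦ val π i ℕ.≟ toℕ i ⟧                ≡⟨ sum-remove {n} {g} (λ i → ⟦ val π i ℕ.≟ toℕ i ⟧) ⟩
      ⟦ val π g ℕ.≟ toℕ g ⟧ + ∑[ i < n ] ⟦ val π (punchIn g i) ℕ.≟ toℕ (punchIn g i) ⟧
        ≡⟨ cong (⟦ val π g ℕ.≟ toℕ g ⟧ +_) (sum-cong-≗ {n} λ i → other (punchIn g i) (Fin.punchInᵢ≢i g i)) ⟩
      ⟦ val π g ℕ.≟ toℕ g ⟧ + ∑[ i < n ] fixed′ (punchIn g i)
        -- A zero term at `g` is put back, so that the sum again runs over all old arcs as they
        -- appear in `τ`.
        ≡⟨ cong (λ m → ⟦ val π g ℕ.≟ toℕ g ⟧ + (m + ∑[ i < n ] fixed′ (punchIn g i)))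
                (⟦⟧-no (s′ g ℕ.≟ i′ g) ¬fixed-g) ⟨
      ⟦ val π g ℕ.≟ toℕ g ⟧ + (fixed′ g + ∑[ i < n ] fixed′ (punchIn g i))
        ≡⟨ cong (⟦ val π g ℕ.≟ toℕ g ⟧ +_) (sum-remove {n} {g} fixed′) ⟨
      ⟦ val π g ℕ.≟ toℕ g ⟧ + sum fixed′
        ≡⟨ cong (λ m → ⟦ val π g ℕ.≟ toℕ g ⟧ + (m + sum fixed′))
                (⟦⟧-no (toℕ h ℕ.≟ toℕ x) (λ h≡x → <⇒≱ (s≤s x≤g) (≤-reflexive h≡x))) ⟨
      ⟦ val π g ℕ.≟ toℕ g ⟧ + (⟦ toℕ h ℕ.≟ toℕ x ⟧ + sum fixed′)
        ≡⟨ cong (⟦ val π g ℕ.≟ toℕ g ⟧ +_) (sum-insert x h π (λ i s → ⟦ s ℕ.≟ i ⟧)) ⟨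
      ⟦ val π g ℕ.≟ toℕ g ⟧ + ∑[ i < suc (suc n) ] ⟦ val τ i ℕ.≟ toℕ i ⟧
        ≡⟨ cong (⟦ val π g ℕ.≟ toℕ g ⟧ +_) (fix-sum τ) ⟨
      ⟦ val π g ℕ.≟ toℕ g ⟧ + fix τ ∎
      where
      fixed′ : Fin (suc n) → ℕ
      fixed′ i = ⟦ s′ i ℕ.≟ i′ i ⟧
      -- Position `g` moves to `h`, and the value `h` belongs to the new arc.
      ¬fixed-g : s′ g ≢ i′ g
      ¬fixed-g eq = Fin.punchInᵢ≢i h (π ⟨$⟩ʳ g) (Fin.toℕ-injective (trans eq (bump-above x≤g (bi g))))
      other : ∀ i → i ≢ g → ⟦ val π i ℕ.≟ toℕ i ⟧ ≡ fixed′ i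
      other i i≢g = ⟦⟧-cong (val π i ℕ.≟ toℕ i) (s′ i ℕ.≟ i′ i)
        (≮≯⇔ (compare (avoids i) (bi i) (bs i))
             (compare-> (i≢g ∘ Fin.toℕ-injective) (avoids i) (bi i) (bs i)))

    -- The value `h` is taken at x < h, so `h` is a peak exactly if position `h`, which was `g` in
    -- `π`, takes a smaller value. No label up to `g` is a peak before or after: these values are
    -- avoided by the open positions, so their positions are not smaller than they are.
    cpk-insert : cpk τ ≡ ⟦ val π g ℕ.≤? toℕ g ⟧ + cpk π
    cpk-insert = begin
      cpk τ                                               ≡⟨ cpk-sum τ ⟩
      ∑[ v < suc (suc n) ] ⟦ cpk? τ v ⟧                   ≡⟨ sum-remove {suc n} {h} (λ v → ⟦ cpk? τ v ⟧) ⟩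
      ⟦ cpk? τ h ⟧ + ∑[ v < suc n ] ⟦ cpk? τ (punchIn h v) ⟧
        ≡⟨ cong₂ _+_ (⟦⟧-cong (cpk? τ h) (val π g ℕ.≤? toℕ g) peak-h)
                     (sum-cong-≗ {suc n} λ v → ⟦⟧-cong (cpk? τ (punchIn h v)) (cpk? π v) (peak-⇔ v)) ⟩
      ⟦ val π g ℕ.≤? toℕ g ⟧ + ∑[ v < suc n ] ⟦ cpk? π v ⟧  ≡⟨ cong (⟦ val π g ℕ.≤? toℕ g ⟧ +_) (cpk-sum π) ⟨
      ⟦ val π g ℕ.≤? toℕ g ⟧ + cpk π                      ∎
      where
      punchIn-g : punchIn x g ≡ h
      punchIn-g = Fin.toℕ-injective (bump-above x≤g (bi g))
      val-h : val τ h ≡ s′ g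
      val-h = cong toℕ (trans (cong (τ ⟨$⟩ʳ_) (sym punchIn-g)) (insert-punchIn x h π g))
      peak-h : (toℕ (τ ⟨$⟩ˡ h) < toℕ h × val τ h < toℕ h) ⇔ val π g ≤ toℕ g
      peak-h = mk⇔
        (λ { (_ , w) → to (bump-≤⇔ (bs g)) (subst (_< toℕ h) val-h w) })
        (λ w → subst (_< toℕ h) (cong toℕ (sym (insert-selfˡ x h π))) (s≤s x≤g)
             , subst (_< toℕ h) (sym val-h) (from (bump-≤⇔ (bs g)) w))
      peak-⇔ : ∀ v → (toℕ (τ ⟨$⟩ˡ punchIn h v) < toℕ (punchIn h v) × val τ (punchIn h v) < toℕ (punchIn h v)) ⇔
                     (toℕ (π ⟨$⟩ˡ v) < toℕ v × val π v < toℕ v)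
      peak-⇔ v with toℕ v ℕ.≤? toℕ g
      ... | yes v≤g = mk⇔
        (λ { (q , _) → contradiction (subst₂ _<_ (cong toℕ (insert-punchInˡ x h π v)) (bump-below (s≤s v≤g) (punchIn-bump h v)) q)
                                     (≤⇒≯ (≤-trans v≤p (bump-≤ (bi p)))) })
        (λ { (q , _) → contradiction q (≤⇒≯ v≤p) })
        where
        p = π ⟨$⟩ˡ v
        v≤p : toℕ v ≤ toℕ p
        v≤p = ≤-trans v≤g (≮⇒≥ λ p<g → <⇒≱ (avoids-position π avoids v p<g) v≤g)
      ... | no v≰g = mk⇔
        (λ { (q , w) → subst (toℕ p <_) (cong toℕ (inverseʳ π)) (from (compare (avoids p) (bi p) (bs p)) (subst₂ _<_ p≡ v≡ q))
                     , from (compare-> v≢g (avoids v) (bi v) (bs v)) (subst₂ _<_ w≡ x≡ w) })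
        (λ { (q , w) → subst₂ _<_ (sym p≡) (sym v≡)
                         (to (compare (avoids p) (bi p) (bs p)) (subst (toℕ p <_) (cong toℕ (sym (inverseʳ π))) q))
                     , subst₂ _<_ (sym w≡) (sym x≡) (to (compare-> v≢g (avoids v) (bi v) (bs v)) w) })
        where
        p = π ⟨$⟩ˡ v
        g<v = ≰⇒> v≰g
        v≢g : toℕ v ≢ toℕ g
        v≢g v≡g = v≰g (≤-reflexive v≡g)
        punchIn≡ : punchIn x v ≡ punchIn h v
        punchIn≡ = punchIn-above x h v (≤-trans x≤g (<⇒≤ g<v)) g<v
        p≡ : toℕ (τ ⟨$⟩ˡ punchIn h v) ≡ i′ p
        p≡ = cong toℕ (insert-punchInˡ x h π v)
        v≡ : toℕ (punchIn h v) ≡ s′ p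
        v≡ = cong (toℕ ∘ punchIn h) (sym (inverseʳ π))
        x≡ : toℕ (punchIn h v) ≡ i′ v
        x≡ = cong toℕ (sym punchIn≡)
        w≡ : val τ (punchIn h v) ≡ s′ v
        w≡ = cong toℕ (trans (cong (τ ⟨$⟩ʳ_) (sym punchIn≡)) (insert-punchIn x h π v))

open Arcs
open Statistics

-- Expanding sums over permutations

inverse-cong : ∀ {σ ρ : Permutation′ n} → σ Perm.≈ ρ → ∀ v → σ ⟨$⟩ˡ v ≡ ρ ⟨$⟩ˡ v
inverse-cong {σ = σ} {ρ} σ≈ρ v = ≡.trans (≡.sym (inverseˡ ρ))
  (cong (ρ ⟨$⟩ˡ_) (≡.trans (≡.sym (σ≈ρ (σ ⟨$⟩ˡ v))) (inverseʳ σ)))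

insert-cong : ∀ x y {π ρ : Permutation′ n} → π Perm.≈ ρ → insert x y π Perm.≈ insert x y ρ
insert-cong x y π≈ρ k with x Fin.≟ k
... | yes _   = ≡.refl
... | no  x≢k = cong (punchIn y) (π≈ρ (punchOut x≢k))

insert-injective : ∀ x y {π ρ : Permutation′ n} → insert x y π Perm.≈ insert x y ρ → π Perm.≈ ρ
insert-injective x y {π} {ρ} eq k = Fin.punchIn-injective y _ _
  (≡.trans (≡.sym (insert-punchIn x y π k)) (≡.trans (eq (punchIn x k)) (insert-punchIn x y ρ k)))

avoids? : ∀ b c (σ : Permutation′ n) → Dec (Avoids b c σ)
avoids? b c σ = Fin.all? λ i → (toℕ i ℕ.<? b) →-dec (c ℕ.≤? val σ i)

avoids-cong : ∀ {b c} {σ ρ : Permutation′ n} → σ Perm.≈ ρ → Avoids b c σ ⇔ Avoids b c ρ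
avoids-cong {c = c} σ≈ρ = mk⇔
  (λ av i i<b → subst (λ w → c ≤ toℕ w) (σ≈ρ i) (av i i<b))
  (λ av i i<b → subst (λ w → c ≤ toℕ w) (≡.sym (σ≈ρ i)) (av i i<b))

-- A choice of n + 1 cells, exactly one of which lies on each permutation.
record Transversal n : Set where
  field
    row column : Fin (suc n) → Fin (suc n)
    meets      : ∀ (σ : Permutation′ (suc n)) → ∃[ z ] σ ⟨$⟩ʳ row z ≡ column z
    once       : ∀ (σ : Permutation′ (suc n)) {y z} →
                 σ ⟨$⟩ʳ row y ≡ column y → σ ⟨$⟩ʳ row z ≡ column z → y ≡ z

rowAt columnAt : Fin (suc n) → Transversal n
rowAt x = record
  { row = λ _ → x ; column = id
  ; meets = λ σ → σ ⟨$⟩ʳ x , ≡.refl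
  ; once = λ σ p q → ≡.trans (≡.sym p) q }
columnAt y = record
  { row = id ; column = λ _ → y
  ; meets = λ σ → σ ⟨$⟩ˡ y , inverseʳ σ
  ; once = λ σ p q → ≡.trans (≡.sym (inverseˡ σ)) (≡.trans (cong (σ ⟨$⟩ˡ_) (≡.trans p (≡.sym q))) (inverseˡ σ)) }

module _ (t : Transversal n) where
  open Transversal t

  expansion : List (Permutation′ (suc n))
  expansion = concatMap (λ z → map (insert (row z) (column z)) (𝔖 n)) (allFin (suc n))

  expansion-complete : ∀ σ → Any (σ Perm.≈_) expansion
  expansion-complete σ with meets σ
  ... | z , σz≡ = Any.concatMap⁺ (λ z → map (insert (row z) (column z)) (𝔖 n))
    (Any.map (λ { ≡.refl → Any.map⁺ (Any.map step (𝔖-complete n (remove (row z) σ))) }) (∈-allFin z))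
    where
    step : ∀ {ρ} → remove (row z) σ Perm.≈ ρ → σ Perm.≈ insert (row z) (column z) ρ
    step {ρ} eq k = ≡.trans (≡.sym (insert-remove (row z) σ k))
      (≡.trans (insert-cong (row z) (σ ⟨$⟩ʳ row z) eq k)
               (cong (λ y → insert (row z) y ρ ⟨$⟩ʳ k) σz≡))

  expansion-unique : AllPairs (λ π ρ → ¬ π Perm.≈ ρ) expansion
  expansion-unique = AllPairs.concat⁺
    (All.map⁺ (All.universal
      (λ z → AllPairs.map⁺ (AllPairs.map (λ π≉ρ eq → π≉ρ (insert-injective (row z) (column z) eq)) (𝔖-unique n)))
      (allFin (suc n))))
    (AllPairs.map⁺ (AllPairs.map
      (λ {y} {z} y≢z → All.map⁺ (All.universal (λ π → All.map⁺ (All.universal (λ ρ eq →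
        y≢z (once (insert (row z) (column z) ρ)
                  (≡.trans (≡.sym (eq (row y))) (insert-self (row y) (column y) π))
                  (insert-self (row z) (column z) ρ))) (𝔖 n))) (𝔖 n)))
      (allFin⁺ (suc n))))

-- Sums over lists with values in a ring

module ListSum {c ℓ} (R : CommutativeRing c ℓ) where
  open CommutativeRing R hiding (zero)
  open import Relation.Binary.Reasoning.Setoid setoid
  open import Algebra.Properties.CommutativeSemigroup +-commutativeSemigroup using (interchange)

  private
    variable
      a b : Level
      A B : Set a

  ⨁ : List A → (A → Carrier) → Carrier
  ⨁ xs f = foldr _+_ 0# (map f xs)

  infixr 5 _▹_
  -- Conditions are guards on the summands, so that the index list stays the same and sums can be
  -- exchanged freely.
  _▹_ : Dec A → Carrier → Carrier
  d ▹ x = if does d then x else 0#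

  ▹-yes : ∀ (d : Dec A) {x} → A → d ▹ x ≈ x
  ▹-yes (yes _) _ = refl
  ▹-yes (no ¬a) a = contradiction a ¬a

  ▹-no : ∀ (d : Dec A) {x} → ¬ A → d ▹ x ≈ 0#
  ▹-no (yes a) ¬a = contradiction a ¬a
  ▹-no (no _)  _  = refl

  ▹-cong : ∀ (d : Dec A) (e : Dec B) {x y} → A ⇔ B → (A → x ≈ y) → d ▹ x ≈ e ▹ y
  ▹-cong d (yes b) A⇔B eq = trans (▹-yes d (from A⇔B b)) (eq (from A⇔B b))
  ▹-cong d (no ¬b) A⇔B eq = ▹-no d (¬b ∘ to A⇔B)

  ▹-congʳ : ∀ (d : Dec A) {x y} → (A → x ≈ y) → d ▹ x ≈ d ▹ y
  ▹-congʳ d = ▹-cong d d (mk⇔ id id)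

  ▹-* : ∀ (d : Dec A) x y → d ▹ (x * y) ≈ (d ▹ x) * y
  ▹-* (yes _) x y = refl
  ▹-* (no _)  x y = sym (zeroˡ y)

  *-▹ : ∀ (d : Dec A) x y → d ▹ (x * y) ≈ x * (d ▹ y)
  *-▹ (yes _) x y = refl
  *-▹ (no _)  x y = sym (zeroʳ x)

  ▹-+ : ∀ (d : Dec A) x y → d ▹ (x + y) ≈ (d ▹ x) + (d ▹ y)
  ▹-+ (yes _) x y = refl
  ▹-+ (no _)  x y = sym (+-identityˡ 0#)

  ▹-× : ∀ (d : Dec A) (e : Dec B) x → (d ×-dec e) ▹ x ≈ d ▹ e ▹ x
  ▹-× (yes _) e x = refl
  ▹-× (no _)  e x = refl

  -- In the half steps, `B` says that the event read closes an arc, and `A′` is the state reached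
  -- when it does not.
  ▹-split : ∀ {a′} {A′ : Set a′} (d : Dec A) (d′ : Dec A′) (e : Dec B) x → A′ ⇔ (A × ¬ B) →
            d ▹ x ≈ (d′ ▹ x) + ((d ×-dec e) ▹ x)
  ▹-split d d′ (yes b) x A′⇔ = sym (trans
    (+-cong (▹-no d′ (λ a → proj₂ (to A′⇔ a) b)) (▹-cong (d ×-dec yes b) d (mk⇔ proj₁ (_, b)) (λ _ → refl)))
    (+-identityˡ _))
  ▹-split d d′ (no ¬b) x A′⇔ = sym (trans
    (+-cong (▹-cong d′ d (mk⇔ (proj₁ ∘ to A′⇔) (λ a → from A′⇔ (a , ¬b))) (λ _ → refl))
            (▹-no (d ×-dec no ¬b) (¬b ∘ proj₂)))
    (+-identityʳ _))

  ⨁-cong : ∀ (xs : List A) {f g} → (∀ x → f x ≈ g x) → ⨁ xs f ≈ ⨁ xs g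
  ⨁-cong []       f≈g = refl
  ⨁-cong (x ∷ xs) f≈g = +-cong (f≈g x) (⨁-cong xs f≈g)

  ⨁-zero : ∀ (xs : List A) {f} → All (λ x → f x ≈ 0#) xs → ⨁ xs f ≈ 0#
  ⨁-zero []       []       = refl
  ⨁-zero (x ∷ xs) (p ∷ ps) = trans (+-cong p (⨁-zero xs ps)) (+-identityˡ 0#)

  ⨁-+ : ∀ (xs : List A) f g → ⨁ xs (λ x → f x + g x) ≈ ⨁ xs f + ⨁ xs g
  ⨁-+ []       f g = sym (+-identityˡ 0#)
  ⨁-+ (x ∷ xs) f g = trans (+-congˡ (⨁-+ xs f g)) (interchange _ _ _ _)

  ⨁-*ˡ : ∀ (xs : List A) k f → ⨁ xs (λ x → k * f x) ≈ k * ⨁ xs f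
  ⨁-*ˡ []       k f = sym (zeroʳ k)
  ⨁-*ˡ (x ∷ xs) k f = trans (+-congˡ (⨁-*ˡ xs k f)) (sym (distribˡ k _ _))

  ⨁-*ʳ : ∀ (xs : List A) f k → ⨁ xs (λ x → f x * k) ≈ ⨁ xs f * k
  ⨁-*ʳ []       f k = sym (zeroˡ k)
  ⨁-*ʳ (x ∷ xs) f k = trans (+-congˡ (⨁-*ʳ xs f k)) (sym (distribʳ k _ _))

  ⨁-▹ : ∀ (xs : List A) (d : Dec B) f → ⨁ xs (λ x → d ▹ f x) ≈ d ▹ ⨁ xs f
  ⨁-▹ xs (yes _) f = refl
  ⨁-▹ xs (no _)  f = ⨁-zero xs (All.universal (λ _ → refl) xs)

  ⨁-swap : ∀ (xs : List A) (ys : List B) (f : A → B → Carrier) → ⨁ xs (λ x → ⨁ ys (f x)) ≈ ⨁ ys (λ y → ⨁ xs (λ x → f x y))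
  ⨁-swap []       ys f = sym (⨁-zero ys (All.universal (λ _ → refl) ys))
  ⨁-swap (x ∷ xs) ys f = trans (+-congˡ (⨁-swap xs ys f)) (sym (⨁-+ ys (f x) (λ y → ⨁ xs (λ x → f x y))))

  ⨁-++ : ∀ (xs ys : List A) f → ⨁ (xs ++ ys) f ≈ ⨁ xs f + ⨁ ys f
  ⨁-++ []       ys f = sym (+-identityˡ _)
  ⨁-++ (x ∷ xs) ys f = trans (+-congˡ (⨁-++ xs ys f)) (sym (+-assoc _ _ _))

  ⨁-map : ∀ (h : A → B) xs f → ⨁ (map h xs) f ≈ ⨁ xs (f ∘ h)
  ⨁-map h []       f = refl
  ⨁-map h (x ∷ xs) f = +-congˡ (⨁-map h xs f)

  ⨁-concatMap : ∀ (h : A → List B) xs f → ⨁ (concatMap h xs) f ≈ ⨁ xs (λ x → ⨁ (h x) f)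
  ⨁-concatMap h []       f = refl
  ⨁-concatMap h (x ∷ xs) f = trans (⨁-++ (h x) (concatMap h xs) f) (+-congˡ (⨁-concatMap h xs f))

  module _ {p} {_∼_ : A → A → Set p} (_∼?_ : Decidable₂ _∼_)
           (∼-sym : ∀ {x y} → x ∼ y → y ∼ x) (∼-trans : ∀ {x y z} → x ∼ y → y ∼ z → x ∼ z) where

    ⨁-select : ∀ {xs} → AllPairs (λ x y → ¬ x ∼ y) xs → ∀ {x} → Any (x ∼_) xs → ∀ k →
               ⨁ xs (λ y → (x ∼? y) ▹ k) ≈ k
    ⨁-select {y ∷ ys} (y≁ ∷ _) {x} (here x∼y) k = trans
      (+-cong (▹-yes (x ∼? y) x∼y)
              (⨁-zero ys (All.map (λ y≁z → ▹-no (x ∼? _) (λ x∼z → y≁z (∼-trans (∼-sym x∼y) x∼z))) y≁)))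
      (+-identityʳ k)
    ⨁-select {y ∷ ys} (y≁ ∷ unique) {x} (there x∈ys) k = trans
      (+-cong (▹-no (x ∼? y) (λ x∼y → All.All¬⇒¬Any (All.map (λ y≁z x∼z → y≁z (∼-trans (∼-sym x∼y) x∼z)) y≁) x∈ys))
              (⨁-select unique x∈ys k))
      (+-identityˡ k)

    -- Each `x` is related to exactly one entry of `ys`, so its summand may be spread over `ys` by
    -- the indicator of the relation; then the two sums are exchanged.
    ⨁-reindex : ∀ {xs ys} f → (∀ {x y} → x ∼ y → f x ≈ f y) →
                AllPairs (λ x y → ¬ x ∼ y) xs → (∀ x → Any (x ∼_) xs) →
                AllPairs (λ x y → ¬ x ∼ y) ys → (∀ x → Any (x ∼_) ys) →
                ⨁ xs f ≈ ⨁ ys f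
    ⨁-reindex {xs} {ys} f f-cong xs! xs-all ys! ys-all = begin
      ⨁ xs f                                         ≈⟨ ⨁-cong xs (λ x → ⨁-select ys! (ys-all x) (f x)) ⟨
      ⨁ xs (λ x → ⨁ ys (λ y → (x ∼? y) ▹ f x))       ≈⟨ ⨁-swap xs ys (λ x y → (x ∼? y) ▹ f x) ⟩
      ⨁ ys (λ y → ⨁ xs (λ x → (x ∼? y) ▹ f x))
        ≈⟨ ⨁-cong ys (λ y → ⨁-cong xs λ x → ▹-cong (x ∼? y) (y ∼? x) (mk⇔ ∼-sym ∼-sym) f-cong) ⟩
      ⨁ ys (λ y → ⨁ xs (λ x → (y ∼? x) ▹ f y))       ≈⟨ ⨁-cong ys (λ y → ⨁-select xs! (xs-all y) (f y)) ⟩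
      ⨁ ys f                                         ∎

  Respects≈ : (Permutation′ n → Carrier) → Set _
  Respects≈ f = ∀ σ ρ → σ Perm.≈ ρ → f σ ≈ f ρ

  -- `𝔖` is built by choosing the image of 0, while the diagram is read at other rows and at
  -- columns. Every transversal lists each permutation once up to `Perm._≈_`, so all these
  -- expansions have the same sum.
  ⨁-expand : (t : Transversal n) → let open Transversal t in ∀ f → Respects≈ f →
             ⨁ (𝔖 (suc n)) f ≈ ⨁ (allFin (suc n)) (λ z → ⨁ (𝔖 n) (f ∘ insert (row z) (column z)))
  ⨁-expand {n} t f f-cong = begin
    ⨁ (𝔖 (suc n)) f
      ≈⟨ ⨁-reindex (λ π ρ → Fin.all? λ i → (π ⟨$⟩ʳ i) Fin.≟ (ρ ⟨$⟩ʳ i))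
           (λ p i → ≡.sym (p i)) (λ p q i → ≡.trans (p i) (q i)) f (f-cong _ _)
           (𝔖-unique (suc n)) (𝔖-complete (suc n)) (expansion-unique t) (expansion-complete t) ⟩
    ⨁ (expansion t) f
      ≈⟨ ⨁-concatMap (λ z → map (insert (row z) (column z)) (𝔖 n)) (allFin (suc n)) f ⟩
    ⨁ (allFin (suc n)) (λ z → ⨁ (map (insert (row z) (column z)) (𝔖 n)) f)
      ≈⟨ ⨁-cong (allFin (suc n)) (λ z → ⨁-map (insert (row z) (column z)) (𝔖 n) f) ⟩
    ⨁ (allFin (suc n)) (λ z → ⨁ (𝔖 n) (f ∘ insert (row z) (column z))) ∎
    where open Transversal t

-- Open ends under the insertion of an arc

bump-≤-suc : ∀ {x i i′} → Bump x i i′ → i′ ≤ suc i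
bump-≤-suc (below _) = n≤1+n _
bump-≤-suc (above _) = ≤-refl

punchIn-view : ∀ (x k : Fin (suc n)) → k ≡ x ⊎ (∃[ i ] k ≡ punchIn x i)
punchIn-view x k with x Fin.≟ k
... | yes x≡k = inj₁ (≡.sym x≡k)
... | no  x≢k = inj₂ (punchOut x≢k , ≡.sym (Fin.punchIn-punchOut x≢k))

-- The positions before `x` take values from `x` on in `π`. These are not below `y`, so inserting
-- `y` raises each of them by one, and deleting it lowers the bound on the values by one.
avoids-insert-row : ∀ (x y : Fin (suc n)) (π : Permutation′ n) → toℕ y ≤ toℕ x →
                    Avoids (toℕ x) (suc (toℕ x)) (insert x y π) ⇔ Avoids (toℕ x) (toℕ x) π
avoids-insert-row x y π y≤x = mk⇔ forth back
  where
  forth : Avoids (toℕ x) (suc (toℕ x)) (insert x y π) → Avoids (toℕ x) (toℕ x) π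
  forth avoids i i<x = s≤s⁻¹ (≤-trans
    (subst (λ w → suc (toℕ x) ≤ toℕ w) (insert-punchIn x y π i)
           (avoids (punchIn x i) (subst (_< toℕ x) (≡.sym (bump-below i<x (punchIn-bump x i))) i<x)))
    (bump-≤-suc (punchIn-bump y (π ⟨$⟩ʳ i))))
  back : Avoids (toℕ x) (toℕ x) π → Avoids (toℕ x) (suc (toℕ x)) (insert x y π)
  back avoids k k<x with punchIn-view x k
  ... | inj₁ ≡.refl = contradiction k<x (<-irrefl ≡.refl)
  ... | inj₂ (i , ≡.refl) = subst (λ w → suc (toℕ x) ≤ toℕ w) (≡.sym (insert-punchIn x y π i))
    (subst (suc (toℕ x) ≤_) (≡.sym (bump-above (≤-trans y≤x x≤πi) (punchIn-bump y (π ⟨$⟩ʳ i)))) (s≤s x≤πi))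
    where
    x≤πi : toℕ x ≤ val π i
    x≤πi = avoids i (≤-<-trans (bump-≤ (punchIn-bump x i)) k<x)

-- The deleted arc starts at one of the open positions, so one fewer is left. Its value `suc g` lies
-- just outside the corner, so the bound on the values is unchanged.
avoids-insert-column : ∀ (x : Fin (suc (suc n))) (g : Fin (suc n)) (π : Permutation′ (suc n)) → toℕ x ≤ toℕ g →
                       Avoids (suc (toℕ g)) (suc (toℕ g)) (insert x (suc g) π) ⇔ Avoids (toℕ g) (suc (toℕ g)) π
avoids-insert-column {n} x g π x≤g = mk⇔ forth back
  where
  h = suc g
  uncovered : ∀ {v v′} → Bump (toℕ h) v v′ → toℕ h ≤ v′ → toℕ h ≤ v
  uncovered (below _)   h≤v = h≤v
  uncovered (above h≤v) _   = h≤v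
  unshifted : ∀ {i i′} → Bump (toℕ x) i i′ → i′ < toℕ h → i < toℕ g
  unshifted (below i<x) _    = <-≤-trans i<x x≤g
  unshifted (above _)   i′≤g = s<s⁻¹ i′≤g
  forth : Avoids (toℕ h) (toℕ h) (insert x h π) → Avoids (toℕ g) (toℕ h) π
  forth avoids i i<g = uncovered (punchIn-bump h (π ⟨$⟩ʳ i))
    (subst (λ w → toℕ h ≤ toℕ w) (insert-punchIn x h π i)
           (avoids (punchIn x i) (≤-<-trans (bump-≤-suc (punchIn-bump x i)) (s<s i<g))))
  back : Avoids (toℕ g) (toℕ h) π → Avoids (toℕ h) (toℕ h) (insert x h π)
  back avoids k k<h with punchIn-view x k
  ... | inj₁ ≡.refl = ≤-reflexive (cong toℕ (≡.sym (insert-self x h π)))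
  ... | inj₂ (i , ≡.refl) = subst (λ w → toℕ h ≤ toℕ w) (≡.sym (insert-punchIn x h π i))
    (≤-trans (avoids i (unshifted (punchIn-bump x i) k<h)) (bump-≤ (punchIn-bump h (π ⟨$⟩ʳ i))))

avoids-row-⇔ : ∀ (x : Fin n) (σ : Permutation′ n) →
               Avoids (suc (toℕ x)) (suc (toℕ x)) σ ⇔ (Avoids (toℕ x) (suc (toℕ x)) σ × ¬ val σ x ≤ toℕ x)
avoids-row-⇔ x σ = mk⇔
  (λ avoids → (λ i i<x → avoids i (≤-trans i<x (n≤1+n _))) , <⇒≱ (avoids x ≤-refl))
  back
  where
  back : Avoids (toℕ x) (suc (toℕ x)) σ × ¬ val σ x ≤ toℕ x → Avoids (suc (toℕ x)) (suc (toℕ x)) σ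
  back (avoids , σx≰x) i i≤x with i Fin.≟ x
  ... | yes ≡.refl = ≰⇒> σx≰x
  ... | no  i≢x    = avoids i (≤∧≢⇒< (s≤s⁻¹ i≤x) (i≢x ∘ Fin.toℕ-injective))

avoids-column-⇔ : ∀ {b} (y : Fin n) (σ : Permutation′ n) →
                  Avoids b (suc (toℕ y)) σ ⇔ (Avoids b (toℕ y) σ × ¬ toℕ (σ ⟨$⟩ˡ y) < b)
avoids-column-⇔ {b = b} y σ = mk⇔
  (λ avoids → (λ i i<b → ≤-trans (n≤1+n _) (avoids i i<b))
            , λ p<b → <-irrefl ≡.refl (avoids-position σ avoids y p<b))
  (λ { (avoids , p≮b) i i<b → ≤∧≢⇒< (avoids i i<b) λ y≡σi →
       p≮b (subst (λ w → toℕ w < b)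
             (≡.trans (≡.sym (inverseˡ σ)) (cong (σ ⟨$⟩ˡ_) (Fin.toℕ-injective (≡.sym y≡σi)))) i<b) })

-- Reading one event of the diagram

module HalfSteps {c ℓ} (R : CommutativeRing c ℓ) where
  open CommutativeRing R hiding (zero)
  open ListSum R
  open import Relation.Binary.Reasoning.Setoid setoid

  Avoiding : ∀ n (b c : ℕ) → (Permutation′ n → Carrier) → Carrier
  Avoiding n b c f = ⨁ (𝔖 n) (λ σ → avoids? b c σ ▹ f σ)

  Avoiding-cong : ∀ {n b c f g} → (∀ σ → Avoids b c σ → f σ ≈ g σ) → Avoiding n b c f ≈ Avoiding n b c g
  Avoiding-cong {n} {b} {c} f≈g = ⨁-cong (𝔖 n) (λ σ → ▹-congʳ (avoids? b c σ) (f≈g σ))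

  Avoiding-*ˡ : ∀ {n b c} k f → Avoiding n b c (λ σ → k * f σ) ≈ k * Avoiding n b c f
  Avoiding-*ˡ {n} {b} {c} k f = trans (⨁-cong (𝔖 n) (λ σ → *-▹ (avoids? b c σ) k (f σ))) (⨁-*ˡ (𝔖 n) k _)

  private
    -- `Q` says that the event closes an arc. These permutations are expanded along the row or
    -- column of the event, whose cells are the candidates for the closed arc.
    split-expand : ∀ {n b c b′ c′} {Q : Permutation′ (suc n) → Set} (Q? : ∀ σ → Dec (Q σ)) →
      (∀ {σ ρ} → σ Perm.≈ ρ → Q σ ⇔ Q ρ) →
      (∀ σ → Avoids b′ c′ σ ⇔ (Avoids b c σ × ¬ Q σ)) →
      (t : Transversal n) → let open Transversal t in ∀ f → Respects≈ f →
      Avoiding (suc n) b c f ≈ Avoiding (suc n) b′ c′ f +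
        ⨁ (allFin (suc n)) (λ z → ⨁ (𝔖 n) (λ π →
          let τ = insert (row z) (column z) π in (avoids? b c τ ×-dec Q? τ) ▹ f τ))
    split-expand {n} {b} {c} {b′} {c′} Q? Q-cong split t f f-cong = begin
      Avoiding (suc n) b c f
        ≈⟨ ⨁-cong (𝔖 (suc n)) (λ σ → ▹-split (avoids? b c σ) (avoids? b′ c′ σ) (Q? σ) (f σ) (split σ)) ⟩
      ⨁ (𝔖 (suc n)) (λ σ → (avoids? b′ c′ σ ▹ f σ) + (cut σ ▹ f σ))
        ≈⟨ ⨁-+ (𝔖 (suc n)) _ _ ⟩
      Avoiding (suc n) b′ c′ f + ⨁ (𝔖 (suc n)) (λ σ → cut σ ▹ f σ)
        ≈⟨ +-congˡ (⨁-expand t (λ σ → cut σ ▹ f σ) (λ σ ρ σ≈ρ → ▹-cong (cut σ) (cut ρ)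
             (mk⇔ (λ { (av , q) → to (avoids-cong {σ = σ} {ρ} σ≈ρ) av , to (Q-cong {σ} {ρ} σ≈ρ) q })
                  (λ { (av , q) → from (avoids-cong {σ = σ} {ρ} σ≈ρ) av , from (Q-cong {σ} {ρ} σ≈ρ) q }))
             (λ _ → f-cong σ ρ σ≈ρ))) ⟩
      _ ∎
      where
      cut = λ σ → avoids? b c σ ×-dec Q? σ

  -- At position `x` all values up to `x` have been read and are open, so an arc may close on any y
  -- ≤ x.
  row-step : ∀ {n} (x : Fin (suc n)) f → Respects≈ f →
    Avoiding (suc n) (toℕ x) (suc (toℕ x)) f ≈
    Avoiding (suc n) (suc (toℕ x)) (suc (toℕ x)) f +
      ⨁ (allFin (suc n)) (λ y → (toℕ y ℕ.≤? toℕ x) ▹ Avoiding n (toℕ x) (toℕ x) (f ∘ insert x y))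
  row-step {n} x f f-cong = trans
    (split-expand (λ σ → val σ x ℕ.≤? toℕ x)
      (λ σ≈ρ → mk⇔ (subst (λ w → toℕ w ≤ toℕ x) (σ≈ρ x)) (subst (λ w → toℕ w ≤ toℕ x) (≡.sym (σ≈ρ x))))
      (avoids-row-⇔ x) (rowAt x) f f-cong)
    (+-congˡ (⨁-cong (allFin (suc n)) λ y → trans
      (⨁-cong (𝔖 n) (λ π → trans
        (▹-cong (avoids? (toℕ x) (suc (toℕ x)) (insert x y π) ×-dec (val (insert x y π) x ℕ.≤? toℕ x))
                ((toℕ y ℕ.≤? toℕ x) ×-dec avoids? (toℕ x) (toℕ x) π) (cut-⇔ y π) (λ _ → refl))
        (▹-× (toℕ y ℕ.≤? toℕ x) (avoids? (toℕ x) (toℕ x) π) (f (insert x y π)))))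
      (⨁-▹ (𝔖 n) (toℕ y ℕ.≤? toℕ x) _)))
    where
    cut-⇔ : ∀ y π → (Avoids (toℕ x) (suc (toℕ x)) (insert x y π) × val (insert x y π) x ≤ toℕ x) ⇔
                    (toℕ y ≤ toℕ x × Avoids (toℕ x) (toℕ x) π)
    cut-⇔ y π = mk⇔
      (λ { (av , y≤x) → let y≤x = subst (λ w → toℕ w ≤ toℕ x) (insert-self x y π) y≤x
                        in y≤x , to (avoids-insert-row x y π y≤x) av })
      (λ { (y≤x , av) → from (avoids-insert-row x y π y≤x) av
                      , subst (λ w → toℕ w ≤ toℕ x) (≡.sym (insert-self x y π)) y≤x })

  -- The value `h` can only be reached from one of the `h` open positions x ≤ g; after deletion
  -- `toℕ g` open positions and `h` open values are left.
  column-step : ∀ {n} (g : Fin (suc n)) f → Respects≈ f → let h = suc (toℕ g) in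
    Avoiding (suc (suc n)) h h f ≈
    Avoiding (suc (suc n)) h (suc h) f +
      ⨁ (allFin (suc (suc n))) (λ x → (toℕ x ℕ.≤? toℕ g) ▹ Avoiding (suc n) (toℕ g) h (f ∘ insert x (suc g)))
  column-step {n} g f f-cong = trans
    (split-expand (λ σ → toℕ (σ ⟨$⟩ˡ suc g) ℕ.<? h)
      (λ {σ} {ρ} σ≈ρ → mk⇔ (subst (λ w → toℕ w < h) (inverse-cong {σ = σ} {ρ} σ≈ρ (suc g)))
                           (subst (λ w → toℕ w < h) (≡.sym (inverse-cong {σ = σ} {ρ} σ≈ρ (suc g)))))
      (avoids-column-⇔ (suc g)) (columnAt (suc g)) f f-cong)
    (+-congˡ (⨁-cong (allFin (suc (suc n))) λ x → trans
      (⨁-cong (𝔖 (suc n)) (λ π → trans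
        (▹-cong (avoids? h h (insert x (suc g) π) ×-dec (toℕ (insert x (suc g) π ⟨$⟩ˡ suc g) ℕ.<? h))
                ((toℕ x ℕ.≤? toℕ g) ×-dec avoids? (toℕ g) h π) (cut-⇔ x π) (λ _ → refl))
        (▹-× (toℕ x ℕ.≤? toℕ g) (avoids? (toℕ g) h π) (f (insert x (suc g) π)))))
      (⨁-▹ (𝔖 (suc n)) (toℕ x ℕ.≤? toℕ g) _)))
    where
    h = suc (toℕ g)
    cut-⇔ : ∀ x π → (Avoids h h (insert x (suc g) π) × toℕ (insert x (suc g) π ⟨$⟩ˡ suc g) < h) ⇔
                    (toℕ x ≤ toℕ g × Avoids (toℕ g) h π)
    cut-⇔ x π = mk⇔
      (λ { (av , p) → let x≤g = s≤s⁻¹ (subst (λ w → toℕ w < h) (insert-selfˡ x (suc g) π) p)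
                      in x≤g , to (avoids-insert-column x g π x≤g) av })
      (λ { (x≤g , av) → from (avoids-insert-column x g π x≤g) av
                      , subst (λ w → toℕ w < h) (≡.sym (insert-selfˡ x (suc g) π)) (s≤s x≤g) })

-- Invariance of the statistics under pointwise equality

module _ {σ ρ : Permutation′ n} (σ≈ρ : σ Perm.≈ ρ) where
  private
    val≡ : ∀ i → val σ i ≡ val ρ i
    val≡ i = cong toℕ (σ≈ρ i)

  pairs-cong : ∀ F → pairs F σ ≡ pairs F ρ
  pairs-cong F = sum-cong-≗ {n} λ i → sum-cong-≗ {n} λ j →
    cong₂ (λ s t → F (toℕ i) s (toℕ j) t) (val≡ i) (val≡ j)

  nest-cong : nest σ ≡ nest ρ
  nest-cong = ≡.trans (nest-pairs σ) (≡.trans (pairs-cong λ i s j t → ⟦ nested? i s j t ⟧) (≡.sym (nest-pairs ρ)))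

  cros-cong : cros σ ≡ cros ρ
  cros-cong = ≡.trans (cros-pairs σ) (≡.trans (pairs-cong λ i s j t → ⟦ crossing? i s j t ⟧) (≡.sym (cros-pairs ρ)))

  exc-cong : exc σ ≡ exc ρ
  exc-cong = ≡.trans (exc-sum σ) (≡.trans (sum-cong-≗ {n} λ i → cong (λ s → ⟦ toℕ i ℕ.<? s ⟧) (val≡ i)) (≡.sym (exc-sum ρ)))

  fix-cong : fix σ ≡ fix ρ
  fix-cong = ≡.trans (fix-sum σ) (≡.trans (sum-cong-≗ {n} λ i → cong (λ s → ⟦ s ℕ.≟ toℕ i ⟧) (val≡ i)) (≡.sym (fix-sum ρ)))

  cpk-cong : cpk σ ≡ cpk ρ
  cpk-cong = ≡.trans (cpk-sum σ) (≡.trans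
    (sum-cong-≗ {n} λ v → cong₂ (λ p s → ⟦ (p ℕ.<? toℕ v) ×-dec (s ℕ.<? toℕ v) ⟧)
                                (cong toℕ (inverse-cong {σ = σ} {ρ} σ≈ρ v)) (val≡ v))
    (≡.sym (cpk-sum ρ)))

-- The recursion for the weighted sums

module Weighted {c ℓ} (R : CommutativeRing c ℓ) (p q X T r : CommutativeRing.Carrier R) where
  open CommutativeRing R hiding (zero)
  open Over R using (_^_)
  open ListSum R
  open HalfSteps R
  open import Algebra.Properties.Semiring.Exp semiring using (^-homo-*)
  open import Algebra.Properties.CommutativeSemigroup *-commutativeSemigroup using (interchange)
  open import Relation.Binary.Reasoning.Setoid setoid

  -- This is the product to which `P` unfolds for five statistics, including the final `1#`, so that
  -- `weight` is its summand by definition.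
  monomial : (a b k e f : ℕ) → Carrier
  monomial a b k e f = p ^ a * (q ^ b * (X ^ k * (T ^ e * (r ^ f * 1#))))

  weight : Permutation′ n → Carrier
  weight σ = monomial (nest σ) (cros σ) (cpk σ) (exc σ) (fix σ)

  monomial-≡ : ∀ {a a′ b b′ k k′ e e′ f f′} → a ≡ a′ → b ≡ b′ → k ≡ k′ → e ≡ e′ → f ≡ f′ →
               monomial a b k e f ≈ monomial a′ b′ k′ e′ f′
  monomial-≡ ≡.refl ≡.refl ≡.refl ≡.refl ≡.refl = refl

  monomial-+ : ∀ a a′ b b′ k k′ e e′ f f′ →
               monomial (a ℕ.+ a′) (b ℕ.+ b′) (k ℕ.+ k′) (e ℕ.+ e′) (f ℕ.+ f′) ≈
               monomial a b k e f * monomial a′ b′ k′ e′ f′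
  monomial-+ a a′ b b′ k k′ e e′ f f′ =
    split p a a′ (split q b b′ (split X k k′ (split T e e′ (split r f f′ (sym (*-identityˡ 1#))))))
    where
    split : ∀ x m n {y z w} → y ≈ z * w → x ^ (m ℕ.+ n) * y ≈ (x ^ m * z) * (x ^ n * w)
    split x m n y≈ = trans (*-cong (^-homo-* x m n) y≈) (interchange _ _ _ _)

  weight-cong : Respects≈ {n} weight
  weight-cong σ ρ σ≈ρ = monomial-≡ (nest-cong {σ = σ} {ρ} σ≈ρ) (cros-cong {σ = σ} {ρ} σ≈ρ)
    (cpk-cong {σ = σ} {ρ} σ≈ρ) (exc-cong {σ = σ} {ρ} σ≈ρ) (fix-cong {σ = σ} {ρ} σ≈ρ)

  weight-extend : ∀ {m n} (τ : Permutation′ m) (π : Permutation′ n) a b k e f →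
                  nest τ ≡ a ℕ.+ nest π → cros τ ≡ b ℕ.+ cros π → cpk τ ≡ k ℕ.+ cpk π →
                  exc τ ≡ e ℕ.+ exc π → fix τ ≡ f ℕ.+ fix π →
                  weight τ ≈ monomial a b k e f * weight π
  weight-extend τ π a b k e f a≡ b≡ k≡ e≡ f≡ = trans (monomial-≡ a≡ b≡ k≡ e≡ f≡)
    (monomial-+ a (nest π) b (cros π) k (cpk π) e (exc π) f (fix π))

  rowMonomial columnMonomial : (g x : ℕ) → Carrier
  rowMonomial    h y = monomial y (h ∸ y) 0 0 ⟦ y ℕ.≟ h ⟧
  columnMonomial g x = monomial x (g ∸ x) 0 1 0

  peakMonomial : (g x y : ℕ) → Carrier
  peakMonomial g x y = monomial (x ℕ.+ y) ((g ∸ x) ℕ.+ (g ∸ y)) 1 1 0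

  weight-row : ∀ (x y : Fin (suc n)) (π : Permutation′ n) → toℕ y ≤ toℕ x → Avoids (toℕ x) (toℕ x) π →
               weight (insert x y π) ≈ rowMonomial (toℕ x) (toℕ y) * weight π
  weight-row x y π y≤x avoids = weight-extend (insert x y π) π
    (toℕ y) (toℕ x ∸ toℕ y) 0 0 ⟦ toℕ y ℕ.≟ toℕ x ⟧ nest-insert cros-insert cpk-insert exc-insert fix-insert
    where open InsertRow x y y≤x π avoids

  -- Position `g` of `π` remains open too, so its value exceeds `g`: no peak arises and no fixed
  -- point is lost.
  weight-column : ∀ (x : Fin (suc (suc n))) (g : Fin (suc n)) π → toℕ x ≤ toℕ g →
                  Avoids (suc (toℕ g)) (suc (toℕ g)) π →
                  weight (insert x (suc g) π) ≈ columnMonomial (toℕ g) (toℕ x) * weight π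
  weight-column x g π x≤g avoids = weight-extend (insert x (suc g) π) π
    (toℕ x) (toℕ g ∸ toℕ x) 0 1 0 nest-insert cros-insert
    (≡.trans cpk-insert (cong (ℕ._+ cpk π) (⟦⟧-no (val π g ℕ.≤? toℕ g) (<⇒≱ g<πg))))
    exc-insert
    (≡.sym (≡.trans fix-insert (cong (ℕ._+ fix (insert x (suc g) π)) (⟦⟧-no (val π g ℕ.≟ toℕ g) (λ eq → <-irrefl (≡.sym eq) g<πg)))))
    where
    g<πg : toℕ g < val π g
    g<πg = avoids g ≤-refl
    open InsertColumn x g x≤g π (λ i i<g → avoids i (≤-trans i<g (n≤1+n _)))

  -- When value `suc g` and the next position both close, the label `suc g` is a cyclic peak, and
  -- the two closings contribute independent powers of `p` and `q`.
  weight-peak : ∀ (x : Fin (suc (suc n))) (g y : Fin (suc n)) π → toℕ x ≤ toℕ g → toℕ y ≤ toℕ g →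
                Avoids (toℕ g) (toℕ g) π →
                weight (insert x (suc g) (insert g y π)) ≈ peakMonomial (toℕ g) (toℕ x) (toℕ y) * weight π
  weight-peak x g y π x≤g y≤g avoids = weight-extend (insert x (suc g) ρ) π
    (toℕ x ℕ.+ toℕ y) ((toℕ g ∸ toℕ x) ℕ.+ (toℕ g ∸ toℕ y)) 1 1 0
    (≡.trans Col.nest-insert (≡.trans (cong (toℕ x ℕ.+_) Row.nest-insert) (≡.sym (ℕ.+-assoc (toℕ x) (toℕ y) (nest π)))))
    (≡.trans Col.cros-insert (≡.trans (cong ((toℕ g ∸ toℕ x) ℕ.+_) Row.cros-insert)
      (≡.sym (ℕ.+-assoc (toℕ g ∸ toℕ x) (toℕ g ∸ toℕ y) (cros π)))))
    (≡.trans Col.cpk-insert (cong₂ ℕ._+_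
      (⟦⟧-yes (val ρ g ℕ.≤? toℕ g) (subst (λ w → toℕ w ≤ toℕ g) (≡.sym (insert-self g y π)) y≤g)) Row.cpk-insert))
    (≡.trans Col.exc-insert (cong suc Row.exc-insert))
    -- For y = g the row insertion creates a fixed point of `ρ` that the column insertion destroys.
    -- Both equations count it in `fix ρ`, and it cancels.
    (ℕ.+-cancelˡ-≡ ⟦ val ρ g ℕ.≟ toℕ g ⟧ _ _ (≡.trans (≡.sym Col.fix-insert) (≡.trans Row.fix-insert
      (cong (λ w → ⟦ toℕ w ℕ.≟ toℕ g ⟧ ℕ.+ fix π) (≡.sym (insert-self g y π))))))
    where
    ρ = insert g y π
    module Row = InsertRow g y y≤g π avoids
    module Col = InsertColumn x g x≤g ρ (from (avoids-insert-row g y π y≤g) avoids)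

  rowTerm columnTerm : (g x : ℕ) → Carrier
  rowTerm    h y = (y ℕ.≤? h) ▹ rowMonomial h y
  columnTerm g x = (x ℕ.≤? g) ▹ columnMonomial g x

  peakTerm : (g x y : ℕ) → Carrier
  peakTerm g x y = (x ℕ.≤? g) ▹ (y ℕ.≤? g) ▹ peakMonomial g x y

  ⨁Fin : ∀ n → (ℕ → Carrier) → Carrier
  ⨁Fin n f = ⨁ (allFin n) (f ∘ toℕ)

  -- The first h positions and the first h values are the ends of open arcs,
  -- so Avoids h h says that none of these arcs is closed by another of them.
  G : (n h : ℕ) → Carrier
  G n h = Avoiding n h h weight

  row-sum : ∀ (x : Fin (suc n)) →
    ⨁ (allFin (suc n)) (λ y → (toℕ y ℕ.≤? toℕ x) ▹ Avoiding n (toℕ x) (toℕ x) (weight ∘ insert x y)) ≈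
    ⨁Fin (suc n) (rowTerm (toℕ x)) * G n (toℕ x)
  row-sum {n} x = trans
    (⨁-cong (allFin (suc n)) λ y → trans
      (▹-congʳ (toℕ y ℕ.≤? toℕ x) λ y≤x → trans
        (Avoiding-cong {n} λ π → weight-row x y π y≤x)
        (Avoiding-*ˡ {n} (rowMonomial (toℕ x) (toℕ y)) weight))
      (▹-* (toℕ y ℕ.≤? toℕ x) _ _))
    (⨁-*ʳ (allFin (suc n)) (rowTerm (toℕ x) ∘ toℕ) (G n (toℕ x)))

  -- With no open position, value 0 must open an arc, so the corners (0, 0) and (0, 1) impose the
  -- same empty condition.
  G-zero : ∀ n → G (suc n) 0 ≈ G (suc n) 1 + ⨁Fin (suc n) (rowTerm 0) * G n 0
  G-zero n = trans
    (⨁-cong (𝔖 (suc n)) λ σ → ▹-cong (avoids? 0 0 σ) (avoids? 0 1 σ) (mk⇔ (λ _ _ ()) (λ _ _ ())) (λ _ → refl))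
    (trans (row-step {n = n} zero weight weight-cong) (+-congˡ (row-sum {n} zero)))

  -- The value and the position labelled `h` can both open (up), one of them can close (the two
  -- kinds of level step), or both can close (down).
  G-suc : ∀ n (g : Fin (suc n)) → let h = suc (toℕ g) in
    G (suc (suc n)) h ≈
    (G (suc (suc n)) (suc h) + ⨁Fin (suc (suc n)) (rowTerm h) * G (suc n) h) +
    (⨁Fin (suc (suc n)) (columnTerm (toℕ g)) * G (suc n) h +
     ⨁Fin (suc (suc n)) (λ x → ⨁Fin (suc n) (peakTerm (toℕ g) x)) * G n (toℕ g))
  G-suc n g = trans (column-step {n = n} g weight weight-cong)
    (+-cong (trans (row-step (suc g) weight weight-cong) (+-congˡ (row-sum (suc g)))) (begin
      ⨁ (allFin (suc (suc n))) (λ x → (toℕ x ℕ.≤? toℕ g) ▹ Avoiding (suc n) (toℕ g) h (weight ∘ insert x (suc g)))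
        ≈⟨ ⨁-cong (allFin (suc (suc n))) column ⟩
      ⨁ (allFin (suc (suc n))) (λ x → columnTerm (toℕ g) (toℕ x) * G (suc n) h +
                                      ⨁Fin (suc n) (peakTerm (toℕ g) (toℕ x)) * G n (toℕ g))
        ≈⟨ ⨁-+ (allFin (suc (suc n))) _ _ ⟩
      _ ≈⟨ +-cong (⨁-*ʳ (allFin (suc (suc n))) (columnTerm (toℕ g) ∘ toℕ) (G (suc n) h))
                  (⨁-*ʳ (allFin (suc (suc n))) (λ x → ⨁Fin (suc n) (peakTerm (toℕ g) (toℕ x))) (G n (toℕ g))) ⟩
      _ ∎))
    where
    h = suc (toℕ g)
    peaks : ∀ x → toℕ x ≤ toℕ g →
      ⨁ (allFin (suc n)) (λ y → (toℕ y ℕ.≤? toℕ g) ▹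
        Avoiding n (toℕ g) (toℕ g) (weight ∘ insert x (suc g) ∘ insert g y)) ≈
      ⨁Fin (suc n) (λ y → (y ℕ.≤? toℕ g) ▹ peakMonomial (toℕ g) (toℕ x) y) * G n (toℕ g)
    peaks x x≤g = trans
      (⨁-cong (allFin (suc n)) λ y → trans
        (▹-congʳ (toℕ y ℕ.≤? toℕ g) λ y≤g → trans
          (Avoiding-cong {n} λ π → weight-peak x g y π x≤g y≤g)
          (Avoiding-*ˡ {n} (peakMonomial (toℕ g) (toℕ x) (toℕ y)) weight))
        (▹-* (toℕ y ℕ.≤? toℕ g) _ _))
      (⨁-*ʳ (allFin (suc n)) _ (G n (toℕ g)))
    column : ∀ x → (toℕ x ℕ.≤? toℕ g) ▹ Avoiding (suc n) (toℕ g) h (weight ∘ insert x (suc g)) ≈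
                   columnTerm (toℕ g) (toℕ x) * G (suc n) h + ⨁Fin (suc n) (peakTerm (toℕ g) (toℕ x)) * G n (toℕ g)
    column x = begin
      x≤g? ▹ Avoiding (suc n) (toℕ g) h (weight ∘ insert x (suc g))
        -- The weight of a column insertion depends on position `g`, so that position is read before
        -- the weight is factored.
        ≈⟨ ▹-congʳ x≤g? (λ x≤g → trans
             (row-step g (weight ∘ insert x (suc g))
               (λ π ρ eq → weight-cong (insert x (suc g) π) (insert x (suc g) ρ) (insert-cong x (suc g) {π} {ρ} eq)))
             (+-cong (trans (Avoiding-cong {suc n} λ π → weight-column x g π x≤g)
                            (Avoiding-*ˡ {suc n} (columnMonomial (toℕ g) (toℕ x)) weight))
                     (peaks x x≤g))) ⟩
      x≤g? ▹ (columnMonomial (toℕ g) (toℕ x) * G (suc n) h + Peaks * G n (toℕ g))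
        ≈⟨ ▹-+ x≤g? _ _ ⟩
      (x≤g? ▹ columnMonomial (toℕ g) (toℕ x) * G (suc n) h) + (x≤g? ▹ Peaks * G n (toℕ g))
        ≈⟨ +-cong (▹-* x≤g? _ _) (trans (▹-* x≤g? _ _) (*-congʳ (sym (⨁-▹ (allFin (suc n)) x≤g? _)))) ⟩
      _ ∎
      where
      x≤g? = toℕ x ℕ.≤? toℕ g
      Peaks = ⨁Fin (suc n) (λ y → (y ℕ.≤? toℕ g) ▹ peakMonomial (toℕ g) (toℕ x) y)

-- Rescaling the recursion

module Scaling {c ℓ} (R : CommutativeRing c ℓ) where
  open CommutativeRing R hiding (zero)
  open Over R using (_^_)
  open ListSum R
  open HalfSteps R using (Avoiding)
  open import Algebra.Solver.Ring.NaturalCoefficients.Default commutativeSemiring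
    using (solve; _:+_; _:*_; _:=_; con)
  open import Relation.Binary.Reasoning.Setoid setoid

  module _ (p q X T r X′ T′ r′ κ : Carrier)
           (peak≈ : κ * κ * (X * T) ≈ X′ * T′) (level≈ : κ * (T + q) ≈ T′ + q) (fixed≈ : κ * r ≈ r′) where
    private
      module W  = Weighted R p q X  T  r
      module W′ = Weighted R p q X′ T′ r′

    scale-peakTerm : ∀ g x y → κ * κ * W.peakTerm g x y ≈ W′.peakTerm g x y
    scale-peakTerm g x y = begin
      κ * κ * ((x ℕ.≤? g) ▹ (y ℕ.≤? g) ▹ W.peakMonomial g x y)   ≈⟨ *-▹ (x ℕ.≤? g) _ _ ⟨
      (x ℕ.≤? g) ▹ κ * κ * ((y ℕ.≤? g) ▹ W.peakMonomial g x y)   ≈⟨ ▹-congʳ (x ℕ.≤? g) (λ _ → sym (*-▹ (y ℕ.≤? g) _ _)) ⟩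
      (x ℕ.≤? g) ▹ (y ℕ.≤? g) ▹ κ * κ * W.peakMonomial g x y
        ≈⟨ ▹-congʳ (x ℕ.≤? g) (λ _ → ▹-congʳ (y ℕ.≤? g) λ _ → monomials (p ^ (x ℕ.+ y)) (q ^ ((g ∸ x) ℕ.+ (g ∸ y)))) ⟩
      W′.peakTerm g x y ∎
      where
      factor : ∀ κ X T A B →
        κ * κ * (A * (B * ((X * 1#) * ((T * 1#) * (1# * 1#))))) ≈ κ * κ * (X * T) * (A * B)
      factor = solve 5 (λ κ X T A B → κ :* κ :* (A :* (B :* ((X :* con 1) :* ((T :* con 1) :* (con 1 :* con 1))))) :=
                                      κ :* κ :* (X :* T) :* (A :* B)) refl
      unfactor : ∀ X T A B → X * T * (A * B) ≈ A * (B * ((X * 1#) * ((T * 1#) * (1# * 1#))))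
      unfactor = solve 4 (λ X T A B → X :* T :* (A :* B) := A :* (B :* ((X :* con 1) :* ((T :* con 1) :* (con 1 :* con 1))))) refl
      monomials : ∀ A B → κ * κ * (A * (B * ((X * 1#) * ((T * 1#) * (1# * 1#))))) ≈
                          A * (B * ((X′ * 1#) * ((T′ * 1#) * (1# * 1#))))
      monomials A B = trans (factor κ X T A B) (trans (*-congʳ peak≈) (unfactor X′ T′ A B))

    scale-rowTerm-zero : ∀ y → κ * W.rowTerm 0 y ≈ W′.rowTerm 0 y
    scale-rowTerm-zero zero = trans (factor κ r) (trans (*-congʳ fixed≈) (unfactor r′))
      where
      factor : ∀ κ r → κ * (1# * (1# * (1# * (1# * ((r * 1#) * 1#))))) ≈ κ * r * 1#
      factor = solve 2 (λ κ r → κ :* (con 1 :* (con 1 :* (con 1 :* (con 1 :* ((r :* con 1) :* con 1))))) :=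
                                κ :* r :* con 1) refl
      unfactor : ∀ r → r * 1# ≈ 1# * (1# * (1# * (1# * ((r * 1#) * 1#))))
      unfactor = solve 1 (λ r → r :* con 1 := con 1 :* (con 1 :* (con 1 :* (con 1 :* ((r :* con 1) :* con 1))))) refl
    scale-rowTerm-zero (suc y) = zeroʳ κ

    -- For y ≤ g the two kinds of level step share p^y q^(g-y): an arc to the left has one more
    -- crossing and adds the factor q, an arc to the right adds T. The remaining index y = g + 1
    -- belongs to the fixed point alone.
    scale-levelTerm : ∀ g y → κ * (W.rowTerm (suc g) y + W.columnTerm g y) ≈ W′.rowTerm (suc g) y + W′.columnTerm g y
    scale-levelTerm g y with ℕ.<-cmp y (suc g)
    ... | tri< (s≤s y≤g) y≢1+g _ = begin
      κ * (W.rowTerm (suc g) y + W.columnTerm g y)   ≈⟨ *-congˡ (open-term X T r) ⟩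
      κ * (A * ((q * B) * (1# * (1# * (1# * 1#)))) + A * (B * (1# * ((T * 1#) * (1# * 1#)))))
        ≈⟨ solve 5 (λ κ T q A B → κ :* (A :* ((q :* B) :* (con 1 :* (con 1 :* (con 1 :* con 1)))) :+
                                         A :* (B :* (con 1 :* ((T :* con 1) :* (con 1 :* con 1))))) :=
                                  κ :* (T :+ q) :* (A :* B)) refl κ T q A B ⟩
      κ * (T + q) * (A * B)                          ≈⟨ *-congʳ level≈ ⟩
      (T′ + q) * (A * B)
        ≈⟨ solve 4 (λ T q A B → (T :+ q) :* (A :* B) :=
                                A :* ((q :* B) :* (con 1 :* (con 1 :* (con 1 :* con 1)))) :+
                                A :* (B :* (con 1 :* ((T :* con 1) :* (con 1 :* con 1))))) refl T′ q A B ⟩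
      A * ((q * B) * (1# * (1# * (1# * 1#)))) + A * (B * (1# * ((T′ * 1#) * (1# * 1#))))
                                                     ≈⟨ open-term X′ T′ r′ ⟨
      W′.rowTerm (suc g) y + W′.columnTerm g y       ∎
      where
      A = p ^ y
      B = q ^ (g ∸ y)
      open-term : ∀ X T r → let module V = Weighted R p q X T r in
        V.rowTerm (suc g) y + V.columnTerm g y ≈
        A * ((q * B) * (1# * (1# * (1# * 1#)))) + A * (B * (1# * ((T * 1#) * (1# * 1#))))
      open-term X T r = +-cong
        (trans (▹-yes (y ℕ.≤? suc g) (ℕ.m≤n⇒m≤1+n y≤g))
               (Weighted.monomial-≡ R p q X T r {y} ≡.refl (ℕ.+-∸-assoc 1 y≤g) (≡.refl {x = 0}) (≡.refl {x = 0})
                 (⟦⟧-no (y ℕ.≟ suc g) y≢1+g)))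
        (▹-yes (y ℕ.≤? g) y≤g)
    ... | tri≈ _ ≡.refl _ = begin
      κ * (W.rowTerm (suc g) y + W.columnTerm g y)   ≈⟨ *-congˡ (closed-term X T r) ⟩
      κ * (A * (B * (1# * (1# * ((r * 1#) * 1#)))) + 0#)
        ≈⟨ solve 4 (λ κ r A B → κ :* (A :* (B :* (con 1 :* (con 1 :* ((r :* con 1) :* con 1)))) :+ con 0) :=
                                κ :* r :* (A :* B)) refl κ r A B ⟩
      κ * r * (A * B)                                ≈⟨ *-congʳ fixed≈ ⟩
      r′ * (A * B)
        ≈⟨ solve 3 (λ r A B → r :* (A :* B) :=
                              A :* (B :* (con 1 :* (con 1 :* ((r :* con 1) :* con 1)))) :+ con 0) refl r′ A B ⟩
      A * (B * (1# * (1# * ((r′ * 1#) * 1#)))) + 0#  ≈⟨ closed-term X′ T′ r′ ⟨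
      W′.rowTerm (suc g) y + W′.columnTerm g y       ∎
      where
      A = p ^ y
      B = q ^ (suc g ∸ y)
      closed-term : ∀ X T r → let module V = Weighted R p q X T r in
        V.rowTerm (suc g) y + V.columnTerm g y ≈ A * (B * (1# * (1# * ((r * 1#) * 1#)))) + 0#
      closed-term X T r = +-cong
        (trans (▹-yes (y ℕ.≤? suc g) ℕ.≤-refl)
               (Weighted.monomial-≡ R p q X T r {y} ≡.refl (≡.refl {x = suc g ∸ y}) (≡.refl {x = 0}) (≡.refl {x = 0})
                 (⟦⟧-yes (y ℕ.≟ suc g) ≡.refl)))
        (▹-no (y ℕ.≤? g) ℕ.1+n≰n)
    ... | tri> _ _ 1+g<y = trans (*-congˡ (absent X T r)) (trans (zeroʳ κ) (sym (absent X′ T′ r′)))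
      where
      absent : ∀ X T r → let module V = Weighted R p q X T r in V.rowTerm (suc g) y + V.columnTerm g y ≈ 0#
      absent X T r = trans
        (+-cong (▹-no (y ℕ.≤? suc g) (ℕ.<⇒≱ 1+g<y)) (▹-no (y ℕ.≤? g) (ℕ.<⇒≱ (ℕ.<-trans (ℕ.n<1+n g) 1+g<y))))
        (+-identityˡ 0#)

    private
      scale-⨁Fin : ∀ k n {f g} → (∀ x → k * f x ≈ g x) → k * W.⨁Fin n f ≈ W.⨁Fin n g
      scale-⨁Fin k n {f} kf≈g = trans (sym (⨁-*ˡ (allFin n) k (f ∘ toℕ))) (⨁-cong (allFin n) (kf≈g ∘ toℕ))

    scale-levels : ∀ n g → κ * (W.⨁Fin n (W.rowTerm (suc g)) + W.⨁Fin n (W.columnTerm g)) ≈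
                           W.⨁Fin n (W′.rowTerm (suc g)) + W.⨁Fin n (W′.columnTerm g)
    scale-levels n g = begin
      κ * (W.⨁Fin n (W.rowTerm (suc g)) + W.⨁Fin n (W.columnTerm g)) ≈⟨ *-congˡ (⨁-+ (allFin n) _ _) ⟨
      κ * W.⨁Fin n (λ y → W.rowTerm (suc g) y + W.columnTerm g y)    ≈⟨ scale-⨁Fin κ n (scale-levelTerm g) ⟩
      W.⨁Fin n (λ y → W′.rowTerm (suc g) y + W′.columnTerm g y)      ≈⟨ ⨁-+ (allFin n) _ _ ⟩
      _ ∎

    scale-peaks : ∀ m n g → κ * κ * W.⨁Fin m (λ x → W.⨁Fin n (W.peakTerm g x)) ≈
                            W.⨁Fin m (λ x → W.⨁Fin n (W′.peakTerm g x))
    scale-peaks m n g = scale-⨁Fin (κ * κ) m λ x → scale-⨁Fin (κ * κ) n (scale-peakTerm g x)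

    -- A diagram that has been read completely has no open arcs.
    avoiding-everything : ∀ n f → Avoiding (suc n) (suc n) (suc n) f ≈ 0#
    avoiding-everything n f = ⨁-zero (𝔖 (suc n)) (All.universal (λ σ →
      ▹-no (avoids? (suc n) (suc n) σ) (λ avoids → ℕ.<⇒≱ (Fin.toℕ<n (σ ⟨$⟩ʳ zero)) (avoids zero (s≤s z≤n)))) _)

    -- Induction on the number `m` of steps left, which drops by one in each alternative. A path
    -- from height h to 0 in m steps has (levels) + 2 (downs) = h + m, whence the exponent `n`.
    scale-G : ∀ m h n → h ℕ.+ m ≡ n → κ ^ n * W.G n h ≈ W′.G n h
    scale-G zero zero    n       ≡.refl = *-identityˡ _
    scale-G zero (suc h) (suc n) eq with ≡.trans (≡.sym (ℕ.+-identityʳ (suc h))) eq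
    ... | ≡.refl = trans (*-congˡ (avoiding-everything n W.weight))
                         (trans (zeroʳ _) (sym (avoiding-everything n W′.weight)))
    scale-G (suc m) zero (suc n) ≡.refl = begin
      κ * κ ^ n * W.G (suc n) 0                     ≈⟨ *-congˡ (W.G-zero n) ⟩
      κ * κ ^ n * (W.G (suc n) 1 + W.⨁Fin (suc n) (W.rowTerm 0) * W.G n 0)
        ≈⟨ solve 5 (λ κ K A L B → κ :* K :* (A :+ L :* B) := κ :* K :* A :+ κ :* L :* (K :* B)) refl κ (κ ^ n) _ _ _ ⟩
      κ * κ ^ n * W.G (suc n) 1 + κ * W.⨁Fin (suc n) (W.rowTerm 0) * (κ ^ n * W.G n 0)
        ≈⟨ +-cong (scale-G m 1 (suc n) ≡.refl)
                  (*-cong (scale-⨁Fin κ (suc n) scale-rowTerm-zero) (scale-G m 0 n ≡.refl)) ⟩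
      W′.G (suc n) 1 + W.⨁Fin (suc n) (W′.rowTerm 0) * W′.G n 0
                                                    ≈⟨ W′.G-zero n ⟨
      W′.G (suc n) 0                                ∎
    scale-G (suc m) (suc h) n eq with ≡.trans (≡.sym (cong suc (ℕ.+-suc h m))) eq
    -- `G-suc` takes its height from a `Fin`, and `ġ` equals `h` only propositionally.
    ... | ≡.refl = subst (λ h → κ ^ N * W.G N (suc h) ≈ W′.G N (suc h)) (Fin.toℕ-fromℕ< h<) (begin
      κ * (κ * K) * W.G N (suc ġ)                    ≈⟨ *-congˡ (W.G-suc (h ℕ.+ m) g) ⟩
      -- The factor κ^N is shared out: all of it to the up term, κ to each level weight and κ² to
      -- the down weight, the rest to the smaller sums.
      _ ≈⟨ solve 8 (λ κ K A L B M P C → κ :* (κ :* K) :* ((A :+ L :* B) :+ (M :* B :+ P :* C)) :=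
                     κ :* (κ :* K) :* A :+ (κ :* (L :+ M) :* (κ :* K :* B) :+ κ :* κ :* P :* (K :* C)))
             refl κ K _ _ _ _ _ _ ⟩
      _ ≈⟨ +-cong (scale-G m (suc (suc ġ)) N (cong (λ h → suc (suc (h ℕ.+ m))) ġ≡h))
             (+-cong (*-cong (scale-levels N ġ) (scale-G m (suc ġ) (suc (h ℕ.+ m)) (cong (λ h → suc (h ℕ.+ m)) ġ≡h)))
                     (*-cong (scale-peaks N (suc (h ℕ.+ m)) ġ) (scale-G m ġ (h ℕ.+ m) (cong (ℕ._+ m) ġ≡h)))) ⟩
      _ ≈⟨ solve 6 (λ A L B M P C → A :+ ((L :+ M) :* B :+ P :* C) := (A :+ L :* B) :+ (M :* B :+ P :* C))
             refl _ _ _ _ _ _ ⟩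
      _ ≈⟨ W′.G-suc (h ℕ.+ m) g ⟨
      W′.G N (suc ġ) ∎)
      where
      N = suc (suc (h ℕ.+ m))
      K = κ ^ (h ℕ.+ m)
      h< : h < suc (h ℕ.+ m)
      h< = s≤s (ℕ.m≤m+n h m)
      g = fromℕ< h<
      ġ = toℕ g
      ġ≡h : ġ ≡ h
      ġ≡h = Fin.toℕ-fromℕ< h<

    scale-weight : ∀ n → κ ^ n * ⨁ (𝔖 n) W.weight ≈ ⨁ (𝔖 n) W′.weight
    scale-weight n = begin
      κ ^ n * ⨁ (𝔖 n) W.weight     ≈⟨ *-congˡ (unrestricted W.weight) ⟩
      κ ^ n * W.G n 0              ≈⟨ scale-G n 0 n ≡.refl ⟩
      W′.G n 0                     ≈⟨ unrestricted W′.weight ⟨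
      ⨁ (𝔖 n) W′.weight            ∎
      where
      unrestricted : ∀ f → ⨁ (𝔖 n) f ≈ Avoiding n 0 0 f
      unrestricted f = ⨁-cong (𝔖 n) λ σ → sym (▹-yes (avoids? 0 0 σ) λ _ ())

-- The parameters of the two identities

module Substitutions {c ℓ} (R : CommutativeRing c ℓ) where
  open CommutativeRing R hiding (zero)
  open Over R
  open ListSum R
  open import Algebra.Properties.AbelianGroup +-abelianGroup using (∙-cancelʳ)
  open import Algebra.Solver.Ring.NaturalCoefficients.Default commutativeSemiring
    using (Polynomial; solve; _:+_; _:*_; _:=_; con)
  open import Relation.Binary.Reasoning.Setoid setoid

  private
    2ᵖ 4ᵖ : ∀ {m} → Polynomial m
    2ᵖ = con 1 :+ con 1
    4ᵖ = 2ᵖ :+ 2ᵖ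

  substitution : ∀ (p q X T r X′ T′ r′ κ : Carrier) →
    κ * κ * (X * T) ≈ X′ * T′ → κ * (T + q) ≈ T′ + q → κ * r ≈ r′ → ∀ n →
    κ ^ n * P (nest ∷ cros ∷ cpk ∷ exc ∷ fix ∷ []) (𝔖 n) (p ∷ q ∷ X ∷ T ∷ r ∷ []) ≈
    P (nest ∷ cros ∷ cpk ∷ exc ∷ fix ∷ []) (𝔖 n) (p ∷ q ∷ X′ ∷ T′ ∷ r′ ∷ [])
  substitution p q X T r X′ T′ r′ κ = Scaling.scale-weight R p q X T r X′ T′ r′ κ

  1#^n≈1# : ∀ n → 1# ^ n ≈ 1#
  1#^n≈1# zero    = refl
  1#^n≈1# (suc n) = trans (*-identityˡ _) (1#^n≈1# n)

  forget-cpk : ∀ n p q T r →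
    P (nest ∷ cros ∷ cpk ∷ exc ∷ fix ∷ []) (𝔖 n) (p ∷ q ∷ 1# ∷ T ∷ r ∷ []) ≈
    P (nest ∷ cros ∷ exc ∷ fix ∷ []) (𝔖 n) (p ∷ q ∷ T ∷ r ∷ [])
  forget-cpk n p q T r = ⨁-cong (𝔖 n) λ σ →
    *-congˡ (*-congˡ (trans (*-congʳ (1#^n≈1# (cpk σ))) (*-identityˡ _)))

  unit-cancelˡ : ∀ {y z w} → Unit y → y * z ≈ y * w → z ≈ w
  unit-cancelˡ {y} {z} {w} (i , iy≈1 , _) eq = begin
    z            ≈⟨ *-identityˡ z ⟨
    1# * z       ≈⟨ *-congʳ iy≈1 ⟨
    i * y * z    ≈⟨ *-assoc i y z ⟩
    i * (y * z)  ≈⟨ *-congˡ eq ⟩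
    i * (y * w)  ≈⟨ *-assoc i y w ⟨
    i * y * w    ≈⟨ *-congʳ iy≈1 ⟩
    1# * w       ≈⟨ *-identityˡ w ⟩
    w            ∎

  sub-add : ∀ x y → x - y + y ≈ x
  sub-add x y = trans (+-assoc x (- y) y) (trans (+-congˡ (-‿inverseˡ y)) (+-identityʳ x))

  /-* : ∀ x y {{y⁻¹ : Unit y}} → (x / y) * y ≈ x
  /-* x y {{i , iy≈1 , _}} = trans (*-assoc x i y) (trans (*-congˡ iy≈1) (*-identityʳ x))

  -- The scaling goes from the right side to the left, with κ = β/α and target X′ = 1, where `cpk`
  -- disappears. The level condition rests on β + δ = (1 + x)(1 + t).
  exc-by-cpk : ∀ n (p q t x r : Carrier)
    {{_ : Unit (1# + x)}} {{_ : Unit (1# + x * t)}} {{_ : Unit ((x + t) * (1# + x * t))}} →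
    P (nest ∷ cros ∷ exc ∷ fix ∷ []) (𝔖 n) (p ∷ q ∷ t * q ∷ r ∷ [])
    ≈ ((1# + x * t) / (1# + x)) ^ n
      * P (nest ∷ cros ∷ cpk ∷ exc ∷ fix ∷ []) (𝔖 n)
          ( p ∷ q
          ∷ ((1# + x) ^ 2 * t) / ((x + t) * (1# + x * t))
          ∷ (q * (x + t)) / (1# + x * t)
          ∷ ((1# + x) * r) / (1# + x * t)
          ∷ [])
  exc-by-cpk n p q t x r {{i , iα≈1 , _}} {{j , jβ≈1 , _}} {{k , kδβ≈1 , _}} = sym (trans
    (substitution p q _ _ _ 1# (t * q) r (β * i) peak≈ level≈ fixed≈ n)
    (forget-cpk n p q (t * q) r))
    where
    α = 1# + x
    β = 1# + x * t
    δ = x + t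
    peak≈ : β * i * (β * i) * (α ^ 2 * t * k * (q * δ * j)) ≈ 1# * (t * q)
    peak≈ = begin
      β * i * (β * i) * (α ^ 2 * t * k * (q * δ * j))
        ≈⟨ solve 8 (λ α β δ i j k t q → β :* i :* (β :* i) :* (α :* (α :* con 1) :* t :* k :* (q :* δ :* j)) :=
                     (i :* α) :* (i :* α) :* (j :* β) :* (k :* (δ :* β)) :* (t :* q)) refl α β δ i j k t q ⟩
      (i * α) * (i * α) * (j * β) * (k * (δ * β)) * (t * q)
        ≈⟨ *-congʳ (*-cong (*-cong (*-cong iα≈1 iα≈1) jβ≈1) kδβ≈1) ⟩
      1# * 1# * 1# * 1# * (t * q)
        ≈⟨ solve 1 (λ y → con 1 :* con 1 :* con 1 :* con 1 :* y := con 1 :* y) refl (t * q) ⟩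
      1# * (t * q) ∎
    level≈ : β * i * (q * δ * j + q) ≈ t * q + q
    level≈ = begin
      β * i * (q * δ * j + q)
        ≈⟨ solve 5 (λ β δ i j q → β :* i :* (q :* δ :* j :+ q) := i :* (δ :* (j :* β) :+ β) :* q) refl β δ i j q ⟩
      i * (δ * (j * β) + β) * q            ≈⟨ *-congʳ (*-congˡ (+-congʳ (*-congˡ jβ≈1))) ⟩
      i * (δ * 1# + β) * q
        ≈⟨ solve 4 (λ x t i q → i :* ((x :+ t) :* con 1 :+ (con 1 :+ x :* t)) :* q :=
                                i :* (con 1 :+ x) :* (t :* q :+ q)) refl x t i q ⟩
      i * α * (t * q + q)                  ≈⟨ *-congʳ iα≈1 ⟩
      1# * (t * q + q)                     ≈⟨ *-identityˡ _ ⟩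
      t * q + q                            ∎
    fixed≈ : β * i * (α * r * j) ≈ r
    fixed≈ = begin
      β * i * (α * r * j)
        ≈⟨ solve 5 (λ α β i j r → β :* i :* (α :* r :* j) := (i :* α) :* (j :* β) :* r) refl α β i j r ⟩
      (i * α) * (j * β) * r                ≈⟨ *-congʳ (*-cong iα≈1 jβ≈1) ⟩
      1# * 1# * r                          ≈⟨ *-congʳ (*-identityˡ 1#) ⟩
      1# * r                               ≈⟨ *-identityˡ r ⟩
      r                                    ∎

  -- With a = 1 + t and b = 1 - t, the discriminant relation factors as
  -- 4xt = (a - s)(a + s) and 4(1 - x)t = (s - b)(s + b), so that
  -- u = (s - b)/(s + b), v = (a - s)/(a + s) and (1 + u)/(1 + uv) = (a + s)/2.
  module _ (t x s u v : Carrier)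
           {{D₁ : Unit (2# * (1# - x) * t)}} {{D₂ : Unit (2# * x * t)}}
           (disc : s ^ 2 ≈ (1# + t) ^ 2 - 4# * x * t)
           (u≈ : u ≈ (1# + t ^ 2 - 2# * x * t - (1# - t) * s) / (2# * (1# - x) * t))
           (v≈ : v ≈ ((1# + t) ^ 2 - 2# * x * t - (1# + t) * s) / (2# * x * t)) where
    private
      a = 1# + t
      b = 1# - t
      y = 1# - x

      b+t≈1 : b + t ≈ 1#
      b+t≈1 = sub-add 1# t

      y+x≈1 : y + x ≈ 1#
      y+x≈1 = sub-add 1# x

      -- Subtracted terms go to the other side, which leaves identities that hold in every
      -- commutative semiring; below, `b` and `y` are atoms known through b + t = 1 and y + x = 1.
      clear-denominator : ∀ z {e f g d} {{_ : Unit d}} → z ≈ (e - f - g) / d → z * d + f + g ≈ e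
      clear-denominator z {e} {f} {g} {d} eq = begin
        z * d + f + g        ≈⟨ +-congʳ (+-congʳ (trans (*-congʳ eq) (/-* _ d))) ⟩
        e - f - g + f + g    ≈⟨ +-assoc _ f g ⟩
        e - f - g + (f + g)  ≈⟨ +-congˡ (+-comm f g) ⟩
        e - f - g + (g + f)  ≈⟨ +-assoc _ g f ⟨
        e - f - g + g + f    ≈⟨ +-congʳ (sub-add (e - f) g) ⟩
        e - f + f            ≈⟨ sub-add e f ⟩
        e                    ∎

    discriminant : s * s + 4# * x * t ≈ a * a
    discriminant = begin
      s * s + 4# * x * t            ≈⟨ +-congʳ (*-congˡ (*-identityʳ s)) ⟨
      s ^ 2 + 4# * x * t            ≈⟨ +-congʳ disc ⟩
      a ^ 2 - 4# * x * t + 4# * x * t  ≈⟨ sub-add _ _ ⟩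
      a ^ 2                         ≈⟨ *-congˡ (*-identityʳ a) ⟩
      a * a                         ∎

    -- Since (1 + t)² = (1 - t)² + 4t, removing 4xt leaves (1 - t)² + 4(1 - x)t.
    discriminant′ : 4# * y * t + b * b ≈ s * s
    discriminant′ = ∙-cancelʳ (4# * x * t) _ _ (begin
      4# * y * t + b * b + 4# * x * t
        ≈⟨ solve 4 (λ x y t b → 4ᵖ :* y :* t :+ b :* b :+ 4ᵖ :* x :* t := 4ᵖ :* (y :+ x) :* t :+ b :* b) refl x y t b ⟩
      4# * (y + x) * t + b * b       ≈⟨ +-congʳ (*-congʳ (*-congˡ (trans y+x≈1 (sym b+t≈1)))) ⟩
      4# * (b + t) * t + b * b
        ≈⟨ solve 2 (λ t b → 4ᵖ :* (b :+ t) :* t :+ b :* b := (b :+ t :+ t) :* (b :+ t :+ t)) refl t b ⟩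
      (b + t + t) * (b + t + t)      ≈⟨ *-cong (+-congʳ b+t≈1) (+-congʳ b+t≈1) ⟩
      a * a                          ≈⟨ discriminant ⟨
      s * s + 4# * x * t             ∎)

    -- The fraction for v is multiplied out, since only `d` is given as a unit. By definition vd =
    -- a² - d - as, and a² - s² = 2d gives (a + s)vd = d(a - s).
    v-equation : (a + s) * v + s ≈ a
    -- The padding added to both sides stands for the terms that would otherwise be subtracted.
    v-equation = unit-cancelˡ D₂ (∙-cancelʳ ((a + s) * d + (a + s) * (a * s)) _ _ (begin
      d * ((a + s) * v + s) + ((a + s) * d + (a + s) * (a * s))
        ≈⟨ solve 4 (λ a s v d → d :* ((a :+ s) :* v :+ s) :+ ((a :+ s) :* d :+ (a :+ s) :* (a :* s)) :=
                     (a :+ s) :* (v :* d :+ d :+ a :* s) :+ d :* s) refl a s v d ⟩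
      (a + s) * (v * d + d + a * s) + d * s     ≈⟨ +-congʳ (*-congˡ (clear-denominator v v≈)) ⟩
      (a + s) * (a ^ 2) + d * s
        ≈⟨ solve 3 (λ a s d → (a :+ s) :* (a :* (a :* con 1)) :+ d :* s := a :* (a :* a) :+ s :* (a :* a) :+ d :* s) refl a s d ⟩
      a * (a * a) + s * (a * a) + d * s         ≈⟨ +-congʳ (+-congʳ (*-congˡ discriminant)) ⟨
      a * (s * s + 4# * x * t) + s * (a * a) + d * s
        ≈⟨ solve 4 (λ a s x t → let d = 2ᵖ :* x :* t in
             a :* (s :* s :+ 4ᵖ :* x :* t) :+ s :* (a :* a) :+ d :* s :=
             d :* a :+ ((a :+ s) :* d :+ (a :+ s) :* (a :* s))) refl a s x t ⟩
      d * a + ((a + s) * d + (a + s) * (a * s)) ∎))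
      where
      d = 2# * x * t

    -- The same computation with s² - b² = 2e; the numerator fits because 1 + t² - 2xt = b² + e.
    u-equation : u * (s + b) + b ≈ s
    u-equation = unit-cancelˡ D₁ (∙-cancelʳ ((s + b) * d + (s + b) * (b * s)) _ _ (begin
      e * (u * (s + b) + b) + ((s + b) * d + (s + b) * (b * s))
        ≈⟨ solve 5 (λ b s u d e → e :* (u :* (s :+ b) :+ b) :+ ((s :+ b) :* d :+ (s :+ b) :* (b :* s)) :=
                     (s :+ b) :* (u :* e :+ d :+ b :* s) :+ e :* b) refl b s u d e ⟩
      (s + b) * (u * e + d + b * s) + e * b     ≈⟨ +-congʳ (*-congˡ (trans (clear-denominator u u≈) 1+t²≈)) ⟩
      (s + b) * (b * b + (e + d)) + e * b
        ≈⟨ solve 5 (λ b s x y t → let d = 2ᵖ :* x :* t ; e = 2ᵖ :* y :* t in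
             (s :+ b) :* (b :* b :+ (e :+ d)) :+ e :* b :=
             b :* (4ᵖ :* y :* t :+ b :* b) :+ (e :* s :+ (s :+ b) :* d :+ s :* (b :* b))) refl b s x y t ⟩
      b * (4# * y * t + b * b) + (e * s + (s + b) * d + s * (b * b))
        ≈⟨ +-congʳ (*-congˡ discriminant′) ⟩
      b * (s * s) + (e * s + (s + b) * d + s * (b * b))
        ≈⟨ solve 4 (λ b s d e → b :* (s :* s) :+ (e :* s :+ (s :+ b) :* d :+ s :* (b :* b)) :=
                     e :* s :+ ((s :+ b) :* d :+ (s :+ b) :* (b :* s))) refl b s d e ⟩
      e * s + ((s + b) * d + (s + b) * (b * s)) ∎))
      where
      d = 2# * x * t
      e = 2# * y * t
      1+t²≈ : 1# + t ^ 2 ≈ b * b + (e + d)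
      1+t²≈ = begin
        1# + t ^ 2                      ≈⟨ +-congʳ (trans (*-cong b+t≈1 b+t≈1) (*-identityˡ 1#)) ⟨
        (b + t) * (b + t) + t ^ 2
          ≈⟨ solve 2 (λ t b → (b :+ t) :* (b :+ t) :+ t :* (t :* con 1) := b :* b :+ 2ᵖ :* (b :+ t) :* t) refl t b ⟩
        b * b + 2# * (b + t) * t        ≈⟨ +-congˡ (*-congʳ (*-congˡ (trans b+t≈1 (sym y+x≈1)))) ⟩
        b * b + 2# * (y + x) * t
          ≈⟨ solve 4 (λ x y t b → b :* b :+ 2ᵖ :* (y :+ x) :* t := b :* b :+ (2ᵖ :* y :* t :+ 2ᵖ :* x :* t)) refl x y t b ⟩
        b * b + (e + d)                 ∎

    -- Writing 2 = a + b, the left side is a + s + u(a - s) by `u-equation`, and a - s = (a + s)v by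
    -- `v-equation`.
    ratio : 2# * (1# + u) ≈ (a + s) * (1# + u * v)
    ratio = ∙-cancelʳ (u * s) _ _ (begin
      2# * (1# + u) + u * s
        ≈⟨ +-congʳ (*-congʳ (+-congˡ b+t≈1)) ⟨
      (1# + (b + t)) * (1# + u) + u * s
        ≈⟨ solve 4 (λ b s t u → (con 1 :+ (b :+ t)) :* (con 1 :+ u) :+ u :* s :=
                                (con 1 :+ t) :+ (u :* (s :+ b) :+ b) :+ u :* (con 1 :+ t)) refl b s t u ⟩
      a + (u * (s + b) + b) + u * a
        ≈⟨ +-congʳ (+-congˡ u-equation) ⟩
      a + s + u * a
        ≈⟨ +-congˡ (*-congˡ v-equation) ⟨
      a + s + u * ((a + s) * v + s)
        ≈⟨ solve 4 (λ a s u v → a :+ s :+ u :* ((a :+ s) :* v :+ s) := (a :+ s) :* (con 1 :+ u :* v) :+ u :* s) refl a s u v ⟩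
      (a + s) * (1# + u * v) + u * s  ∎)

  -- Now κ = (a + s)/2, so 2κv = a - s. The sum of 2κ and 2κv is 2a, which is the level condition,
  -- and their product a² - s² = 4xt is the peak condition.
  cpk-by-exc : ∀ n (p q t x r s u v : Carrier)
    {{_ : Unit (2# * (1# - x) * t)}} {{_ : Unit (2# * x * t)}} {{_ : Unit (1# + u)}} {{_ : Unit (1# + u * v)}} →
    s ^ 2 ≈ (1# + t) ^ 2 - 4# * x * t →
    u ≈ (1# + t ^ 2 - 2# * x * t - (1# - t) * s) / (2# * (1# - x) * t) →
    v ≈ ((1# + t) ^ 2 - 2# * x * t - (1# + t) * s) / (2# * x * t) →
    P (nest ∷ cros ∷ cpk ∷ exc ∷ fix ∷ []) (𝔖 n) (p ∷ q ∷ x ∷ q * t ∷ r ∷ [])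
    ≈ ((1# + u) / (1# + u * v)) ^ n
      * P (nest ∷ cros ∷ exc ∷ fix ∷ []) (𝔖 n)
          (p ∷ q ∷ q * v ∷ ((1# + u * v) * r) / (1# + u) ∷ [])
  cpk-by-exc n p q t x r s u v {{D₁}} {{D₂}} {{i , iα≈1 , _}} {{j , jβ≈1 , _}} disc u≈ v≈ = sym (trans
    (*-congˡ (sym (forget-cpk n p q (q * v) _)))
    (substitution p q 1# (q * v) _ x (q * t) r κ peak≈ level≈ fixed≈ n))
    where
    a = 1# + t
    α = 1# + u
    β = 1# + u * v
    κ = α * j
    v-eq : (a + s) * v + s ≈ a
    v-eq = v-equation t x s u v {{D₁}} {{D₂}} disc u≈ v≈
    -- 2 can be cancelled because it divides the unit 2xt.
    halve : ∀ {z w} → 2# * z ≈ 2# * w → z ≈ w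
    halve {z} {w} eq = unit-cancelˡ D₂ (trans (swap z) (trans (*-congˡ eq) (sym (swap w))))
      where
      swap : ∀ z → 2# * x * t * z ≈ x * t * (2# * z)
      swap = solve 3 (λ x t z → 2ᵖ :* x :* t :* z := x :* t :* (2ᵖ :* z)) refl x t
    2κ≈ : 2# * κ ≈ a + s
    2κ≈ = begin
      2# * (α * j)             ≈⟨ *-assoc 2# α j ⟨
      2# * α * j               ≈⟨ *-congʳ (ratio t x s u v {{D₁}} {{D₂}} disc u≈ v≈) ⟩
      (a + s) * β * j          ≈⟨ trans (*-assoc _ β j) (*-congˡ (*-comm β j)) ⟩
      (a + s) * (j * β)        ≈⟨ *-congˡ jβ≈1 ⟩
      (a + s) * 1#             ≈⟨ *-identityʳ _ ⟩
      a + s                    ∎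
    4κ²v≈ : (a + s) * ((a + s) * v) ≈ 4# * x * t
    4κ²v≈ = ∙-cancelʳ (s * s) _ _ (begin
      (a + s) * ((a + s) * v) + s * s
        ≈⟨ solve 3 (λ a s w → (a :+ s) :* w :+ s :* s := a :* w :+ s :* (w :+ s)) refl a s ((a + s) * v) ⟩
      a * ((a + s) * v) + s * ((a + s) * v + s)   ≈⟨ +-congˡ (*-congˡ v-eq) ⟩
      a * ((a + s) * v) + s * a
        ≈⟨ solve 3 (λ a s w → a :* w :+ s :* a := a :* (w :+ s)) refl a s ((a + s) * v) ⟩
      a * ((a + s) * v + s)                       ≈⟨ *-congˡ v-eq ⟩
      a * a                                       ≈⟨ discriminant t x s u v {{D₁}} {{D₂}} disc u≈ v≈ ⟨
      s * s + 4# * x * t                          ≈⟨ +-comm _ _ ⟩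
      4# * x * t + s * s                          ∎)
    peak≈ : κ * κ * (1# * (q * v)) ≈ x * (q * t)
    peak≈ = halve (halve (begin
      2# * (2# * (κ * κ * (1# * (q * v))))
        ≈⟨ solve 3 (λ κ q v → 2ᵖ :* (2ᵖ :* (κ :* κ :* (con 1 :* (q :* v)))) :=
                              (2ᵖ :* κ) :* ((2ᵖ :* κ) :* v) :* q) refl κ q v ⟩
      2# * κ * (2# * κ * v) * q                   ≈⟨ *-congʳ (*-cong 2κ≈ (*-congʳ 2κ≈)) ⟩
      (a + s) * ((a + s) * v) * q                 ≈⟨ *-congʳ 4κ²v≈ ⟩
      4# * x * t * q
        ≈⟨ solve 3 (λ x t q → 4ᵖ :* x :* t :* q := 2ᵖ :* (2ᵖ :* (x :* (q :* t)))) refl x t q ⟩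
      2# * (2# * (x * (q * t)))                   ∎))
    level≈ : κ * (q * v + q) ≈ q * t + q
    level≈ = halve (begin
      2# * (κ * (q * v + q))
        ≈⟨ solve 3 (λ κ q v → 2ᵖ :* (κ :* (q :* v :+ q)) := ((2ᵖ :* κ) :* v :+ 2ᵖ :* κ) :* q) refl κ q v ⟩
      (2# * κ * v + 2# * κ) * q                   ≈⟨ *-congʳ (+-cong (*-congʳ 2κ≈) 2κ≈) ⟩
      ((a + s) * v + (a + s)) * q
        ≈⟨ solve 4 (λ w a s q → (w :+ (a :+ s)) :* q := ((w :+ s) :+ a) :* q) refl ((a + s) * v) a s q ⟩
      ((a + s) * v + s + a) * q                   ≈⟨ *-congʳ (+-congʳ v-eq) ⟩
      (a + a) * q
        ≈⟨ solve 2 (λ t q → (con 1 :+ t :+ (con 1 :+ t)) :* q := 2ᵖ :* (q :* t :+ q)) refl t q ⟩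
      2# * (q * t + q)                            ∎)
    fixed≈ : κ * (β * r * i) ≈ r
    fixed≈ = begin
      α * j * (β * r * i)
        ≈⟨ solve 5 (λ α β i j r → α :* j :* (β :* r :* i) := (i :* α) :* (j :* β) :* r) refl α β i j r ⟩
      (i * α) * (j * β) * r                       ≈⟨ *-congʳ (*-cong iα≈1 jβ≈1) ⟩
      1# * 1# * r                                 ≈⟨ *-congʳ (*-identityˡ 1#) ⟩
      1# * r                                      ≈⟨ *-identityˡ r ⟩
      r                                           ∎

theorem3p10 : ∀ {c ℓ} (R : CommutativeRing c ℓ) (n : ℕ) → n ≥ 1 →
  let open CommutativeRing R
      open Over R
  in
  (∀ (p q t x r : Carrier)
     {{_ : Unit (1# + x)}}
     {{_ : Unit (1# + x * t)}}
     {{_ : Unit ((x + t) * (1# + x * t))}} →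
     P (nest ∷ cros ∷ exc ∷ fix ∷ []) (𝔖 n) (p ∷ q ∷ t * q ∷ r ∷ [])
     ≈ ((1# + x * t) / (1# + x)) ^ n
       * P (nest ∷ cros ∷ cpk ∷ exc ∷ fix ∷ []) (𝔖 n)
           ( p ∷ q
           ∷ ((1# + x) ^ 2 * t) / ((x + t) * (1# + x * t))
           ∷ (q * (x + t)) / (1# + x * t)
           ∷ ((1# + x) * r) / (1# + x * t)
           ∷ []))
  ×
  (∀ (p q t x r s u v : Carrier)
     {{_ : Unit (2# * (1# - x) * t)}}
     {{_ : Unit (2# * x * t)}}
     {{_ : Unit (1# + u)}}
     {{_ : Unit (1# + u * v)}} →
     s ^ 2 ≈ (1# + t) ^ 2 - 4# * x * t →
     u ≈ (1# + t ^ 2 - 2# * x * t - (1# - t) * s) / (2# * (1# - x) * t) →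
     v ≈ ((1# + t) ^ 2 - 2# * x * t - (1# + t) * s) / (2# * x * t) →
     P (nest ∷ cros ∷ cpk ∷ exc ∷ fix ∷ []) (𝔖 n) (p ∷ q ∷ x ∷ q * t ∷ r ∷ [])
     ≈ ((1# + u) / (1# + u * v)) ^ n
       * P (nest ∷ cros ∷ exc ∷ fix ∷ []) (𝔖 n)
           (p ∷ q ∷ q * v ∷ ((1# + u * v) * r) / (1# + u) ∷ []))
theorem3p10 R n _ = Substitutions.exc-by-cpk R n , Substitutions.cpk-by-exc R n
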